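{- Fix positive integers $p,q$ such that $2 < \frac{p}{q} < 4$. Suppose a graph $G$ folds to a graph $H$. If $H$ is not $(p,q)$-mixing, then $G$ is not $(p,q)$-mixing. In particular, for $p = 2q+1$, a bipartite connected graph $G$ is $(p,q)$-mixing if and only if $G$ does not fold to the cycle $C_{4q+2}$.
   Context: Graphs are finite and simple. A $(p,q)$-colouring of $G$ is a map $f: V(G) \to \{0,1,\dots,p-1\}$ such that $q \leq |f(u)-f(v)| \leq p-q$ for every edge $uv$. $G$ is $(p,q)$-mixing if any two $(p,q)$-colourings of $G$ are joined by a finite sequence of $(p,q)$-colourings of $G$ in which consecutive colourings differ on at most one vertex (vacuously true if there are none). For vertices $x,y$ of $G$ at distance exactly $2$, let $G_{xy}$ be the (simple) graph obtained by identifying $x$ and $y$ into a new vertex $v_{xy}$; the homomorphism $G\to G_{xy}$ sending $x,y\mapsto v_{xy}$ and fixing all other vertices is an elementary fold. $G$ folds to $H$ if there is a homomorphism $f: G\to H$ which is a composition of (zero or more) elementary folds with $f(G)$ isomorphic to $H$. $C_n$ is the cycle on $n$ vertices. -}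

module Defs where

open import Data.Bool.Base using (Bool)
open import Data.Fin.Base using (Fin; toℕ; punchOut)
open import Data.Fin.Properties using (_≟_; any?; punchOut-injective)
open import Data.Nat.Base
  using (ℕ; suc; _+_; _*_; _∸_; _≤_; _<_; z≤n; s≤s; ∣_-_∣; NonZero)
import Data.Nat.Properties as ℕ
open import Data.Product.Base using (Σ; ∃; ∃₂; _×_; _,_; proj₁; proj₂)
open import Data.Sum.Base using (_⊎_; inj₁; inj₂; swap)
open import Function.Base using (id; _∘_; _on_)
open import Function.Bundles using (_↔_; _⇔_; Inverse)
open import Level using (0ℓ)
open import Relation.Binary.Core using (Rel)
open import Relation.Binary.Construct.Closure.ReflexiveTransitive using (Star)
open import Relation.Binary.Definitions using (Decidable; Irreflexive; Symmetric)
open import Relation.Binary.PropositionalEquality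
  using (_≡_; _≢_; refl; sym; trans; cong)
open import Relation.Nullary using (¬_; yes; no)
open import Relation.Nullary.Decidable using (_×-dec_; _⊎-dec_)

private
  variable
    l m n : ℕ

-- Adjacency is required to be decidable because the graphs are finite objects;
-- classically this is no restriction.
record Graph (n : ℕ) : Set₁ where
  field
    Adj        : Rel (Fin n) 0ℓ
    adj?       : Decidable Adj
    adj-sym    : Symmetric Adj
    adj-irrefl : Irreflexive _≡_ Adj

open Graph public

data Walk (G : Graph n) : ℕ → Fin n → Fin n → Set where
  []  : ∀ {u} → Walk G 0 u u
  _∷_ : ∀ {k u v w} → Adj G u v → Walk G k v w → Walk G (suc k) u w

Distance : Graph n → Fin n → Fin n → ℕ → Set
Distance G u v d = Walk G d u v × (∀ k → k < d → ¬ Walk G k u v)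

-- With this definition the graph on no vertices counts as connected.
Connected : Graph n → Set
Connected G = ∀ u v → ∃ λ k → Walk G k u v

Bipartite : Graph n → Set
Bipartite {n} G = ∃ λ (side : Fin n → Bool) → ∀ {u v} → Adj G u v → side u ≢ side v

module _ (n : ℕ) where

  Successor : Rel (Fin n) 0ℓ
  Successor i j = (toℕ j ≡ suc (toℕ i)) ⊎ (suc (toℕ i) ≡ n × toℕ j ≡ 0)

  private
    successor? : Decidable Successor
    successor? i j =
      (toℕ j ℕ.≟ suc (toℕ i)) ⊎-dec ((suc (toℕ i) ℕ.≟ n) ×-dec (toℕ j ℕ.≟ 0))

    successor-irrefl : 3 ≤ n → ∀ i → ¬ Successor i i
    successor-irrefl 3≤n i (inj₁ i≡1+i) = ℕ.1+n≢n (sym i≡1+i)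
    successor-irrefl 3≤n i (inj₂ (1+i≡n , i≡0))
      with s≤s () ← ℕ.≤-trans 3≤n (ℕ.≤-reflexive (trans (sym 1+i≡n) (cong suc i≡0)))

  cycle : 3 ≤ n → Graph n
  cycle 3≤n = record
    { Adj        = λ i j → Successor i j ⊎ Successor j i
    ; adj?       = λ i j → successor? i j ⊎-dec successor? j i
    ; adj-sym    = swap
    ; adj-irrefl = λ where
        refl (inj₁ s) → successor-irrefl 3≤n _ s
        refl (inj₂ s) → successor-irrefl 3≤n _ s
    }

3≤4q+2 : ∀ q .{{_ : NonZero q}} → 3 ≤ 4 * q + 2
3≤4q+2 (suc q) = ℕ.+-monoˡ-≤ 2 (s≤s z≤n)

record Hom (G : Graph m) (H : Graph n) : Set where
  constructor hom
  field
    map      : Fin m → Fin n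
    preserve : ∀ {u v} → Adj G u v → Adj H (map u) (map v)

idHom : {G : Graph n} → Hom G G
idHom = hom id id

infixr 9 _∘Hom_

_∘Hom_ : {G : Graph l} {H : Graph m} {K : Graph n} → Hom H K → Hom G H → Hom G K
hom g g-pres ∘Hom hom f f-pres = hom (g ∘ f) (g-pres ∘ f-pres)

infix 4 _≅_

_≅_ : Graph m → Graph n → Set
_≅_ {m} {n} G H =
  Σ (Fin m ↔ Fin n) λ φ →
    ∀ u v → Adj G u v ⇔ Adj H (Inverse.to φ u) (Inverse.to φ v)

-- The quotient map Fin (suc n) → Fin n identifying y with x: the vertex y is
-- removed, and the vertex x that remains plays the role of v_xy.
merge : (x y : Fin (suc n)) → y ≢ x → Fin (suc n) → Fin n
merge x y y≢x v with y ≟ v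
... | yes _  = punchOut y≢x
... | no y≢v = punchOut y≢v

private
  merge-kernel : (x y : Fin (suc n)) (y≢x : y ≢ x) → ∀ u v →
                 merge x y y≢x u ≡ merge x y y≢x v →
                 u ≡ v ⊎ (u ≡ x × v ≡ y) ⊎ (u ≡ y × v ≡ x)
  merge-kernel x y y≢x u v eq with y ≟ u | y ≟ v
  ... | yes refl | yes refl = inj₁ refl
  ... | yes refl | no y≢v   = inj₂ (inj₂ (refl , sym (punchOut-injective y≢x y≢v eq)))
  ... | no y≢u   | yes refl = inj₂ (inj₁ (punchOut-injective y≢u y≢x eq , refl))
  ... | no y≢u   | no y≢v   = inj₁ (punchOut-injective y≢u y≢v eq)

module _ (G : Graph (suc n)) (x y : Fin (suc n)) (dist2 : Distance G x y 2) where

  private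
    y≢x : y ≢ x
    y≢x refl = proj₂ dist2 0 (s≤s z≤n) []

    ¬x~y : ¬ Adj G x y
    ¬x~y x~y = proj₂ dist2 1 (s≤s (s≤s z≤n)) (x~y ∷ [])

  foldMap : Fin (suc n) → Fin n
  foldMap = merge x y y≢x

  -- The graph G_xy.
  identify : Graph n
  identify = record
    { Adj        = λ a b → ∃₂ λ u v → foldMap u ≡ a × foldMap v ≡ b × Adj G u v
    ; adj?       = λ a b → any? λ u → any? λ v →
                     (foldMap u ≟ a) ×-dec (foldMap v ≟ b) ×-dec adj? G u v
    ; adj-sym    = λ (u , v , u↦a , v↦b , u~v) → v , u , v↦b , u↦a , adj-sym G u~v
    ; adj-irrefl = λ { refl (u , v , u↦a , v↦a , u~v) →
                       loopless u v (trans u↦a (sym v↦a)) u~v }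
    }
    where
    loopless : ∀ u v → foldMap u ≡ foldMap v → ¬ Adj G u v
    loopless u v eq u~v with merge-kernel x y y≢x u v eq
    ... | inj₁ u≡v                  = adj-irrefl G u≡v u~v
    ... | inj₂ (inj₁ (refl , refl)) = ¬x~y u~v
    ... | inj₂ (inj₂ (refl , refl)) = ¬x~y (adj-sym G u~v)

  elementaryFold : Hom G identify
  elementaryFold = hom foldMap λ u~v → _ , _ , refl , refl , u~v

data FoldComposition : {G : Graph m} {K : Graph n} → Hom G K → Set₁ where
  none : {G : Graph n} → FoldComposition (idHom {G = G})
  step : {G : Graph (suc m)} {K : Graph n} (x y : Fin (suc m)) (dist2 : Distance G x y 2)
         {f : Hom (identify G x y dist2) K} → FoldComposition f →
         FoldComposition (f ∘Hom elementaryFold G x y dist2)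

-- Elementary folds are surjective on vertices and on edges, so the codomain K
-- of a composition f of elementary folds of G is exactly the image f(G).
infix 4 _FoldsTo_

_FoldsTo_ : Graph m → Graph n → Set₁
G FoldsTo H =
  ∃ λ k → Σ (Graph k) λ K → Σ (Hom G K) λ f → FoldComposition f × K ≅ H

-- Truncated subtraction is harmless: if p < q, then q ≤ d ≤ p ∸ q = 0 is
-- impossible, just like q ≤ d ≤ p - q.
IsColouring : (p q : ℕ) → Graph n → (Fin n → Fin p) → Set
IsColouring p q G f =
  ∀ {u v} → Adj G u v →
    q ≤ ∣ toℕ (f u) - toℕ (f v) ∣ × ∣ toℕ (f u) - toℕ (f v) ∣ ≤ p ∸ q

Colouring : (p q : ℕ) → Graph n → Set
Colouring {n} p q G = Σ (Fin n → Fin p) (IsColouring p q G)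

DifferAtMostOnce : {A : Set} → Rel (Fin n → A) 0ℓ
DifferAtMostOnce f g = ∀ u v → f u ≢ g u → f v ≢ g v → u ≡ v

-- Pointwise equal colourings are one step apart, so no function
-- extensionality is needed to connect them.
Mixing : (p q : ℕ) → Graph n → Set
Mixing p q G = (f g : Colouring p q G) → Star (DifferAtMostOnce on proj₁) f g

{-# OPTIONS --safe #-}

-- On an edge uv a colouring f has a gap g = f(v) - f(u) mod p with q ≤ g ≤ p - q.
-- Recolouring one vertex changes the gaps at it by at most p - 2q < p/2, so all of them
-- change by the same integer; a sequence of recolourings from f to g thus yields
-- integers D with g = f + D whose differences are the changes of the gaps (a homotopy).
-- A homotopy from f to its reflection - f amounts to a height function E for f, that is,
-- E(v) - E(u) = 2 gap - p on edges.  Conversely, if f has a height function, a homotopy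
-- from f to g is realised by unit moves: raise a vertex of least height among those
-- with D > 0, or do the same from g to f.  Homotopies and height functions agree on x
-- and y if the colourings do, so they descend to G_xy, and mixing is inherited by folds.
--
-- For p = 2q + 1 heights change by ±1 on edges, and going once round C_{4q+2} one can
-- climb all the way, so C_{4q+2} is not mixing.  Conversely, let G be connected and
-- bipartite with a colouring f.  If two neighbours of a vertex share a colour, fold them
-- and induct.  Otherwise a vertex without a higher neighbour can be lowered, which
-- creates such a pair; and if there is none, G is a cycle of length divisible by p and
-- different from p.  Either it is C_{2p}, or it is longer and can be recoloured so that
-- two neighbours of a vertex share a colour while there is still no height function.
-- Hence G folds to C_{2p} or all its colourings have height functions.
module Submission where

open import Data.Bool.Base using (Bool; not)
open import Data.Bool.Properties using (¬-not; not-¬; not-involutive)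
open import Data.Fin.Base using (Fin; zero; suc; toℕ; fromℕ<; punchIn)
open import Data.Fin.Properties
  using (_≟_; any?; toℕ<n; toℕ-fromℕ<; toℕ-injective;
         punchIn-punchOut; punchIn-injective; punchInᵢ≢i; pigeonhole)
open import Data.Integer.Base using (ℤ; 0ℤ; 1ℤ)
open import Data.Integer.Divisibility.Signed
  using (_∣_; divides; ∣⇒∣ᵤ; ∣m∣n⇒∣m+n; ∣m⇒∣-m; ∣n⇒∣m*n)
open import Data.Integer.DivMod using (_%ℕ_; _/ℕ_; n%ℕd<d; a≡a%ℕn+[a/ℕn]*n)
import Data.Integer.Base as ℤ
import Data.Integer.Properties as ℤ
open import Data.Integer.Tactic.RingSolver using (solve-∀)
open import Data.List.Base using (filter; allFin)
open import Data.List.Extrema ℤ.≤-totalOrder using (argmin; argmin-all; f[argmin]≤f[xs])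
open import Data.List.Membership.Propositional.Properties using (∈-allFin; ∈-filter⁺)
open import Data.List.Relation.Unary.All using (lookup)
open import Data.List.Relation.Unary.All.Properties using (all-filter)
import Data.Nat.Base as ℕ
open import Data.Nat.Base using (ℕ; NonZero)
import Data.Nat.Divisibility as ℕ
open import Data.Nat.GeneralisedArithmetic using (fold)
open import Data.Nat.Induction using (<-wellFounded)
import Data.Nat.Properties as ℕ
open import Data.Nat.Tactic.RingSolver using () renaming (solve-∀ to ℕ-solve-∀)
open import Data.Product.Base using (Σ; ∃; ∃₂; _×_; _,_; proj₁; proj₂)
open import Data.Rational.Unnormalised.Base using (*<*)
open import Data.Sum.Base using (_⊎_; inj₁; inj₂; [_,_]′)
open import Defs
open import Function.Base using (id; _∘_; _on_)
open import Function.Bundles using (Inverse; Equivalence; mk↔ₛ′; mk⇔)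
open import Function.Definitions using (Injective)
open import Induction.WellFounded using (Acc; acc)
open import Level using (0ℓ)
open import Relation.Binary.Construct.Closure.ReflexiveTransitive using (Star; ε; _◅_; _◅◅_)
open import Relation.Binary.Definitions using (tri<; tri≈; tri>)
open import Relation.Binary.PropositionalEquality
open import Relation.Nullary using (¬_; Dec; yes; no; ¬?; contradiction)
open import Relation.Nullary.Decidable using (_×-dec_; decidable-stable)
open import Relation.Unary using (Pred; Decidable)

open import Algebra.Properties.Monoid.Sum ℕ.+-0-monoid using (sum; sum-cong-≗)

-- Integer inequalities by comparison of slacks.

module IntegerLemmas where

  open import Data.Integer.Base using (+_; _+_; _*_; _-_; -_; _≤_)

  -- Linear arithmetic by certificate: an inequality holds once its slack is exhibited as a sum of
  -- known slacks, an identity left to the ring solver.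
  ≤-by : ∀ {a b c d} → a ≤ b → b - a ≡ d - c → c ≤ d
  ≤-by a≤b eq = ℤ.0≤i-j⇒j≤i (subst (0ℤ ≤_) eq (ℤ.i≤j⇒0≤j-i a≤b))

  ≤-by₂ : ∀ {a b a′ b′ c d} → a ≤ b → a′ ≤ b′ → (b - a) + (b′ - a′) ≡ d - c → c ≤ d
  ≤-by₂ a≤b a′≤b′ eq = ℤ.0≤i-j⇒j≤i
    (subst (0ℤ ≤_) eq (ℤ.+-mono-≤ (ℤ.i≤j⇒0≤j-i a≤b) (ℤ.i≤j⇒0≤j-i a′≤b′)))

  ≤-by₃ : ∀ {a b a′ b′ a″ b″ c d} → a ≤ b → a′ ≤ b′ → a″ ≤ b″ →
          (b - a) + (b′ - a′) + (b″ - a″) ≡ d - c → c ≤ d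
  ≤-by₃ a≤b a′≤b′ a″≤b″ eq = ℤ.0≤i-j⇒j≤i
    (subst (0ℤ ≤_) eq
      (ℤ.+-mono-≤ (ℤ.+-mono-≤ (ℤ.i≤j⇒0≤j-i a≤b) (ℤ.i≤j⇒0≤j-i a′≤b′)) (ℤ.i≤j⇒0≤j-i a″≤b″)))

  halve-≡ : ∀ {a b} → + 2 * a ≡ + 2 * b → a ≡ b
  halve-≡ = ℤ.*-cancelˡ-≡ (+ 2) _ _

  +∣-∣-≤ : ∀ {m n} → m ℕ.≤ n → + ℕ.∣ m - n ∣ ≡ + n - + m
  +∣-∣-≤ {m} {n} m≤n = trans (cong +_ (ℕ.m≤n⇒∣m-n∣≡n∸m m≤n)) (trans (sym (ℤ.⊖-≥ m≤n)) (sym (ℤ.m-n≡m⊖n n m)))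

  +∣-∣-≥ : ∀ {m n} → n ℕ.≤ m → + ℕ.∣ m - n ∣ ≡ + m - + n
  +∣-∣-≥ {m} {n} n≤m = trans (cong +_ (ℕ.∣-∣-comm m n)) (+∣-∣-≤ n≤m)

  -- Strict inequalities are kept in the form `1ℤ + a ≤ b`, which the certificates above accept.
  halve-< : ∀ {a b} → 1ℤ + + 2 * a ≤ + 2 * b → 1ℤ + a ≤ b
  halve-< {a} {b} = ℤ.i<j⇒suc[i]≤j ∘ ℤ.*-cancelˡ-<-nonNeg {a} {b} (+ 2) ∘ ℤ.suc[i]≤j⇒i<j

open IntegerLemmas

-- Congruence modulo p, residues and gaps between colours.

module Mod (p : ℕ) .{{_ : NonZero p}} where

  open import Data.Integer.Base using (+_; -[1+_]; _+_; _*_; _-_; -_; _≤_; _<_; ∣_∣; +≤+; +<+)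

  infix 4 _≋_

  -- A record rather than bare divisibility, so that `x` and `y` can be inferred from the type.
  record _≋_ (x y : ℤ) : Set where
    constructor mod
    field
      divisible : + p ∣ x - y

  open _≋_ public

  ≋-by : ∀ {x y z w} → x ≋ y → x - y ≡ z - w → z ≋ w
  ≋-by (mod d) eq = mod (subst (+ p ∣_) eq d)

  ≋-by₂ : ∀ {x y x′ y′ z w} → x ≋ y → x′ ≋ y′ → (x - y) + (x′ - y′) ≡ z - w → z ≋ w
  ≋-by₂ (mod d) (mod e) eq = mod (subst (+ p ∣_) eq (∣m∣n⇒∣m+n d e))

  ≋-by₃ : ∀ {x y x′ y′ x″ y″ z w} → x ≋ y → x′ ≋ y′ → x″ ≋ y″ →
          (x - y) + (x′ - y′) + (x″ - y″) ≡ z - w → z ≋ w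
  ≋-by₃ (mod d) (mod d′) (mod d″) eq = mod (subst (+ p ∣_) eq (∣m∣n⇒∣m+n (∣m∣n⇒∣m+n d d′) d″))

  ≋-reflexive : ∀ {x y} → x ≡ y → x ≋ y
  ≋-reflexive {x} refl = mod (divides 0ℤ (ℤ.+-inverseʳ x))

  ≋-refl : ∀ {x} → x ≋ x
  ≋-refl = ≋-reflexive refl

  ≋-sym : ∀ {x y} → x ≋ y → y ≋ x
  ≋-sym {x} {y} (mod d) = mod (subst (+ p ∣_) (eq x y) (∣m⇒∣-m d))
    where
    eq : ∀ x y → - (x - y) ≡ y - x
    eq = solve-∀

  ≋-trans : ∀ {x y z} → x ≋ y → y ≋ z → x ≋ z
  ≋-trans {x} {y} {z} d e = ≋-by₂ d e (eq x y z)
    where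
    eq : ∀ x y z → (x - y) + (y - z) ≡ x - z
    eq = solve-∀

  ≋-+ : ∀ {x y x′ y′} → x ≋ y → x′ ≋ y′ → x + x′ ≋ y + y′
  ≋-+ {x} {y} {x′} {y′} d e = ≋-by₂ d e (eq x y x′ y′)
    where
    eq : ∀ x y x′ y′ → (x - y) + (x′ - y′) ≡ (x + x′) - (y + y′)
    eq = solve-∀

  ≋-neg : ∀ {x y} → x ≋ y → - x ≋ - y
  ≋-neg {x} {y} d = ≋-by (≋-sym d) (eq x y)
    where
    eq : ∀ x y → y - x ≡ - x - - y
    eq = solve-∀

  ≋-- : ∀ {x y x′ y′} → x ≋ y → x′ ≋ y′ → x - x′ ≋ y - y′
  ≋-- d e = ≋-+ d (≋-neg e)

  ≋-p : ∀ {x y} → x ≋ y → x ≋ y + + p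
  ≋-p {x} {y} d = ≋-by₂ d (mod {0ℤ} {+ p} (divides (- 1ℤ) (eq (+ p)))) (eq′ x y (+ p))
    where
    eq : ∀ p → 0ℤ - p ≡ - 1ℤ * p
    eq = solve-∀
    eq′ : ∀ x y p → (x - y) + (0ℤ - p) ≡ x - (y + p)
    eq′ = solve-∀

  -- A multiple of p of absolute value below p is zero.
  ≋-small : ∀ {x y} → x ≋ y → 1ℤ + (x - y) ≤ + p → 1ℤ + (y - x) ≤ + p → x ≡ y
  ≋-small {x} {y} (mod d) lo hi = ℤ.i-j≡0⇒i≡j x y (ℤ.∣i∣≡0⇒i≡0 ∣x-y∣≡0)
    where
    eq : ∀ x y → y - x ≡ - (x - y)
    eq = solve-∀
    small : ∀ z → z < + p → - z < + p → ∣ z ∣ ℕ.< p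
    small (+ n) (+<+ n<p) _ = n<p
    small -[1+ n ] _ (+<+ n<p) = n<p
    ∣x-y∣≡0 : ∣ x - y ∣ ≡ 0
    ∣x-y∣≡0 with ∣ x - y ∣ | ∣⇒∣ᵤ d
                | small (x - y) (ℤ.suc[i]≤j⇒i<j lo) (subst (_< + p) (eq x y) (ℤ.suc[i]≤j⇒i<j hi))
    ... | ℕ.zero | _ | _ = refl
    ... | ℕ.suc n | p∣ | lt = contradiction (ℕ.∣⇒≤ p∣) (ℕ.<⇒≱ lt)

  residue : ℤ → ℤ
  residue z = + (z %ℕ p)

  residue≥0 : ∀ z → 0ℤ ≤ residue z
  residue≥0 z = +≤+ ℕ.z≤n

  residue<p : ∀ z → 1ℤ + residue z ≤ + p
  residue<p z = +≤+ (n%ℕd<d z p)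

  residue-≋ : ∀ z → residue z ≋ z
  residue-≋ z = ≋-sym (mod (divides (z /ℕ p)
    (trans (cong (_- residue z) (a≡a%ℕn+[a/ℕn]*n z p)) (eq (residue z) _))))
    where
    eq : ∀ r s → (r + s) - r ≡ s
    eq = solve-∀

  residue-unique : ∀ {s z} → 0ℤ ≤ s → 1ℤ + s ≤ + p → s ≋ z → residue z ≡ s
  residue-unique {s} {z} 0≤s s<p s≋z =
    ≋-small (≋-trans (residue-≋ z) (≋-sym s≋z))
      (≤-by₂ (residue<p z) 0≤s (eq (residue z) s (+ p)))
      (≤-by₂ s<p (residue≥0 z) (eq s (residue z) (+ p)))
    where
    eq : ∀ r s p → (p - (1ℤ + r)) + (s - 0ℤ) ≡ p - (1ℤ + (r - s))
    eq = solve-∀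

  ⟦_⟧ : Fin p → ℤ
  ⟦ a ⟧ = + toℕ a

  ⟦⟧<p : ∀ a → 1ℤ + ⟦ a ⟧ ≤ + p
  ⟦⟧<p a = +≤+ (toℕ<n a)

  reduce : ℤ → Fin p
  reduce z = fromℕ< (n%ℕd<d z p)

  reduce-≋ : ∀ z → ⟦ reduce z ⟧ ≋ z
  reduce-≋ z = subst (_≋ z) (cong +_ (sym (toℕ-fromℕ< _))) (residue-≋ z)

  ⟦⟧-injective : ∀ {a b} → ⟦ a ⟧ ≋ ⟦ b ⟧ → a ≡ b
  ⟦⟧-injective {a} {b} eq = toℕ-injective (ℤ.+-injective
    (trans (sym (residue-unique (+≤+ ℕ.z≤n) (⟦⟧<p a) ≋-refl))
           (residue-unique (+≤+ ℕ.z≤n) (⟦⟧<p b) (≋-sym eq))))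

  -- The residue, less p if it exceeds p/2; the factor 2 avoids halving p.
  centred : ∀ z → ∃ λ d → d ≋ z × - + p ≤ + 2 * d × + 2 * d ≤ + p
  centred z with + 2 * residue z ℤ.≤? + p
  ... | yes 2r≤p = residue z , residue-≋ z ,
    ≤-by₃ (residue≥0 z) (residue≥0 z) (+≤+ (ℕ.z≤n {p})) (eq (residue z) (+ p)) , 2r≤p
    where
    eq : ∀ r p → (r - 0ℤ) + (r - 0ℤ) + (p - 0ℤ) ≡ + 2 * r - - p
    eq = solve-∀
  ... | no 2r≰p = residue z - + p ,
    ≋-by (≋-p (residue-≋ z)) (eq₁ z (residue z) (+ p)) ,
    ≤-by₂ (ℤ.i<j⇒suc[i]≤j (ℤ.≰⇒> 2r≰p)) (+≤+ (ℕ.z≤n {1})) (eq₂ (residue z) (+ p)) ,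
    ≤-by₃ (residue<p z) (residue<p z) (+≤+ (ℕ.z≤n {p ℕ.+ 2})) (eq₃ (residue z) (+ p))
    where
    eq₁ : ∀ z r p → r - (z + p) ≡ (r - p) - z
    eq₁ = solve-∀
    eq₂ : ∀ r p → (+ 2 * r - (1ℤ + p)) + (1ℤ - 0ℤ) ≡ + 2 * (r - p) - - p
    eq₂ = solve-∀
    eq₃ : ∀ r p → (p - (1ℤ + r)) + (p - (1ℤ + r)) + ((p + + 2) - 0ℤ) ≡ p - + 2 * (r - p)
    eq₃ = solve-∀

  -- Outside this block the gap is known only through its congruence and its characterisation as the
  -- residue, and never unfolds to a division.
  abstract
    gap : Fin p → Fin p → ℤ
    gap a b = residue (⟦ b ⟧ - ⟦ a ⟧)

    gap-≋ : ∀ a b → gap a b ≋ ⟦ b ⟧ - ⟦ a ⟧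
    gap-≋ a b = residue-≋ _

    gap-residue : ∀ {s a b} → 0ℤ ≤ s → 1ℤ + s ≤ + p → s ≋ ⟦ b ⟧ - ⟦ a ⟧ → gap a b ≡ s
    gap-residue = residue-unique

  -- The bridge from the absolute differences in `IsColouring` to gaps: which case occurs depends on
  -- which of the two colours is larger.
  gap-dist : ∀ a b → gap a b ≡ + ℕ.∣ toℕ a - toℕ b ∣ ⊎ gap a b ≡ + p - + ℕ.∣ toℕ a - toℕ b ∣
  gap-dist a b with toℕ a ℕ.≤? toℕ b
  ... | yes a≤b = inj₁ (gap-residue (+≤+ ℕ.z≤n)
    (≤-by₂ (⟦⟧<p b) (+≤+ (ℕ.z≤n {toℕ a})) (trans (eq ⟦ a ⟧ ⟦ b ⟧ (+ p)) (cong (λ d → + p - (1ℤ + d)) (sym δ≡))))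
    (≋-reflexive δ≡))
    where
    δ≡ : + ℕ.∣ toℕ a - toℕ b ∣ ≡ ⟦ b ⟧ - ⟦ a ⟧
    δ≡ = +∣-∣-≤ a≤b
    eq : ∀ a b p → (p - (1ℤ + b)) + (a - 0ℤ) ≡ p - (1ℤ + (b - a))
    eq = solve-∀
  ... | no a≰b = inj₂ (gap-residue
    (≤-by₃ (⟦⟧<p a) (+≤+ (ℕ.z≤n {toℕ b})) (+≤+ (ℕ.z≤n {1}))
      (trans (eq₁ ⟦ a ⟧ ⟦ b ⟧ (+ p)) (cong (λ d → + p - d - 0ℤ) (sym δ≡))))
    (≤-by (ℤ.i<j⇒suc[i]≤j (+<+ (ℕ.≰⇒> a≰b)))
      (trans (eq₂ ⟦ a ⟧ ⟦ b ⟧ (+ p)) (cong (λ d → + p - (1ℤ + (+ p - d))) (sym δ≡))))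
    (≋-by (≋-sym (≋-p (≋-refl {⟦ b ⟧ - ⟦ a ⟧})))
      (trans (eq₃ ⟦ a ⟧ ⟦ b ⟧ (+ p)) (cong (λ d → (+ p - d) - (⟦ b ⟧ - ⟦ a ⟧)) (sym δ≡)))))
    where
    δ≡ : + ℕ.∣ toℕ a - toℕ b ∣ ≡ ⟦ a ⟧ - ⟦ b ⟧
    δ≡ = +∣-∣-≥ (ℕ.<⇒≤ (ℕ.≰⇒> a≰b))
    eq₁ : ∀ a b p → (p - (1ℤ + a)) + (b - 0ℤ) + (1ℤ - 0ℤ) ≡ p - (a - b) - 0ℤ
    eq₁ = solve-∀
    eq₂ : ∀ a b p → a - (1ℤ + b) ≡ p - (1ℤ + (p - (a - b)))
    eq₂ = solve-∀
    eq₃ : ∀ a b p → ((b - a) + p) - (b - a) ≡ (p - (a - b)) - (b - a)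
    eq₃ = solve-∀

-- Sums, minima and displacements of a single vertex.

sum-mono-≤ : ∀ {n} {f g : Fin n → ℕ} → (∀ i → f i ℕ.≤ g i) → sum f ℕ.≤ sum g
sum-mono-≤ {ℕ.zero} f≤g = ℕ.z≤n
sum-mono-≤ {ℕ.suc n} f≤g = ℕ.+-mono-≤ (f≤g zero) (sum-mono-≤ (f≤g ∘ suc))

sum-mono-< : ∀ {n} {f g : Fin n → ℕ} → (∀ i → f i ℕ.≤ g i) → ∀ i → f i ℕ.< g i → sum f ℕ.< sum g
sum-mono-< f≤g zero    f<g = ℕ.+-mono-<-≤ f<g (sum-mono-≤ (f≤g ∘ suc))
sum-mono-< f≤g (suc i) f<g = ℕ.+-mono-≤-< (f≤g zero) (sum-mono-< (f≤g ∘ suc) i f<g)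

minimal : ∀ {n} {P : Pred (Fin n) 0ℓ} → Decidable P → (E : Fin n → ℤ) → ∃ P →
          ∃ λ v → P v × (∀ u → P u → E v ℤ.≤ E u)
minimal {n} P? E (v , Pv) =
  argmin E v candidates ,
  argmin-all E Pv (all-filter P? (allFin n)) ,
  λ u Pu → lookup (f[argmin]≤f[xs] v candidates) (∈-filter⁺ P? (∈-allFin u) Pu)
  where candidates = filter P? (allFin n)

-- The displacement of a recolouring that moves only `v`.
spike : ∀ {n} → Fin n → ℤ → Fin n → ℤ
spike v e w with w ≟ v
... | yes _ = e
... | no _  = 0ℤ

spike-at : ∀ {n} (v : Fin n) e → spike v e v ≡ e
spike-at v e with v ≟ v
... | yes _  = refl
... | no v≢v = contradiction refl v≢v

spike-off : ∀ {n} {v w : Fin n} e → w ≢ v → spike v e w ≡ 0ℤ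
spike-off {v = v} {w} e w≢v with w ≟ v
... | yes w≡v = contradiction w≡v w≢v
... | no _    = refl

differ-sym : ∀ {n} {A : Set} {f g : Fin n → A} → DifferAtMostOnce f g → DifferAtMostOnce g f
differ-sym once u v gu≢fu gv≢fv = once u v (gu≢fu ∘ sym) (gv≢fv ∘ sym)

-- Homotopies and height functions of circular colourings.

module Circular (p q : ℕ) .{{_ : NonZero p}} .{{_ : NonZero q}} (2q<p : 2 ℕ.* q ℕ.< p) where

  open import Data.Integer.Base using (+_; _+_; _*_; _-_; -_; _≤_; _<_; ∣_∣; +≤+; +<+)

  open Mod p public

  1≤q : 1ℤ ≤ + q
  1≤q = +≤+ (ℕ.>-nonZero⁻¹ q)

  1+2q≤p : 1ℤ + + 2 * + q ≤ + p
  1+2q≤p = subst (λ z → 1ℤ + z ≤ + p) (ℤ.pos-* 2 q) (+≤+ 2q<p)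

  -- This interval is symmetric under s ↦ p - s, so neither the direction of an edge nor the choice
  -- between absolute difference and gap affects membership.
  Range : ℤ → Set
  Range s = + q ≤ s × s ≤ + p - + q

  range≥0 : ∀ {s} → Range s → 0ℤ ≤ s
  range≥0 (q≤s , _) = ℤ.≤-trans (+≤+ ℕ.z≤n) q≤s

  range<p : ∀ {s} → Range s → 1ℤ + s ≤ + p
  range<p {s} (_ , s≤p-q) = ≤-by₂ s≤p-q 1≤q (eq s (+ p) (+ q))
    where
    eq : ∀ s p q → ((p - q) - s) + (q - 1ℤ) ≡ p - (1ℤ + s)
    eq = solve-∀

  range-flip : ∀ {s} → Range s → Range (+ p - s)
  range-flip {s} (q≤s , s≤p-q) = ≤-by s≤p-q (eq₁ s (+ p) (+ q)) , ≤-by q≤s (eq₂ s (+ p) (+ q))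
    where
    eq₁ : ∀ s p q → (p - q) - s ≡ (p - s) - q
    eq₁ = solve-∀
    eq₂ : ∀ s p q → s - q ≡ (p - q) - (p - s)
    eq₂ = solve-∀

  gap-unique : ∀ {s a b} → Range s → s ≋ ⟦ b ⟧ - ⟦ a ⟧ → gap a b ≡ s
  gap-unique r = gap-residue (range≥0 r) (range<p r)

  gap-flip : ∀ {a b} → Range (gap a b) → gap b a ≡ + p - gap a b
  gap-flip {a} {b} r = gap-unique (range-flip r)
    (≋-sym (≋-by (≋-p (≋-neg (≋-sym (gap-≋ a b)))) (eq (gap a b) ⟦ a ⟧ ⟦ b ⟧ (+ p))))
    where
    eq : ∀ g a b p → - (b - a) - (- g + p) ≡ (a - b) - (p - g)
    eq = solve-∀

  private
    q≤p : q ℕ.≤ p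
    q≤p = ℤ.drop‿+≤+ (≤-by₃ 1+2q≤p (+≤+ (ℕ.z≤n {1})) (+≤+ (ℕ.z≤n {q})) (eq (+ p) (+ q)))
      where
      eq : ∀ p q → (p - (1ℤ + + 2 * q)) + (1ℤ - 0ℤ) + (q - 0ℤ) ≡ p - q
      eq = solve-∀

    -- The truncated subtraction in `IsColouring` is a genuine one, as q ≤ p.
    p∸q : + (p ℕ.∸ q) ≡ + p - + q
    p∸q = trans (sym (ℤ.⊖-≥ q≤p)) (sym (ℤ.m-n≡m⊖n p q))

  Near : ℕ → Set
  Near d = q ℕ.≤ d × d ℕ.≤ p ℕ.∸ q

  near⇒range : ∀ {d} → Near d → Range (+ d)
  near⇒range {d} (lo , hi) = +≤+ lo , subst (+ d ≤_) p∸q (+≤+ hi)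

  range⇒near : ∀ {d} → Range (+ d) → Near d
  range⇒near {d} (lo , hi) = ℤ.drop‿+≤+ lo , ℤ.drop‿+≤+ (subst (+ d ≤_) (sym p∸q) hi)

  near⇒gap-range : ∀ a b → Near ℕ.∣ toℕ a - toℕ b ∣ → Range (gap a b)
  near⇒gap-range a b near with gap-dist a b
  ... | inj₁ eq = subst Range (sym eq) (near⇒range near)
  ... | inj₂ eq = subst Range (sym eq) (range-flip (near⇒range near))

  gap-range⇒near : ∀ {a b} → Range (gap a b) → Near ℕ.∣ toℕ a - toℕ b ∣
  gap-range⇒near {a} {b} r with gap-dist a b
  ... | inj₁ eq = range⇒near (subst Range eq r)
  ... | inj₂ eq = range⇒near (subst Range p-[p-d] (range-flip (subst Range eq r)))
    where
    eq′ : ∀ p d → p - (p - d) ≡ d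
    eq′ = solve-∀
    p-[p-d] = eq′ (+ p) (+ ℕ.∣ toℕ a - toℕ b ∣)

  gap-+-≋ : ∀ {a b a′ b′ d e} → ⟦ a′ ⟧ ≋ ⟦ a ⟧ + d → ⟦ b′ ⟧ ≋ ⟦ b ⟧ + e →
            gap a′ b′ ≋ gap a b + (e - d)
  gap-+-≋ {a} {b} {a′} {b′} {d} {e} a′≋ b′≋ =
    ≋-by₂ (≋-trans (gap-≋ a′ b′) (≋-- b′≋ a′≋)) (≋-sym (gap-≋ a b)) (eq (gap a b) (gap a′ b′) ⟦ a ⟧ ⟦ b ⟧ d e)
    where
    eq : ∀ g g′ a b d e → (g′ - ((b + e) - (a + d))) + ((b - a) - g) ≡ g′ - (g + (e - d))
    eq = solve-∀

  module _ {n} (G : Graph n) where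

    private
      Map = Fin n → Fin p

    gap-range : (c : Colouring p q G) → ∀ {u v} → Adj G u v → Range (gap (proj₁ c u) (proj₁ c v))
    gap-range (f , col) {u} {v} u~v = near⇒gap-range (f u) (f v) (col u~v)

    -- Modulo p, `gaps` follows from `moved`; its content is that it holds in the integers, so that
    -- no edge wraps around.
    record Homotopy (f g : Map) (D : Fin n → ℤ) : Set where
      constructor homotopy
      field
        moved : ∀ v → ⟦ g v ⟧ ≋ ⟦ f v ⟧ + D v
        gaps  : ∀ {u v} → Adj G u v → gap (g u) (g v) ≡ gap (f u) (f v) + (D v - D u)

    open Homotopy public

    -- The factor 2 keeps heights integral: E(v) - E(u) is twice the deviation of the gap from p/2.
    record Height (f : Map) (E : Fin n → ℤ) : Set where
      constructor height
      field
        slope : ∀ {u v} → Adj G u v → E v - E u ≡ + 2 * gap (f u) (f v) - + p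

    open Height public

    homotopy-refl : ∀ {f} → Homotopy f f (λ _ → 0ℤ)
    homotopy-refl .moved v = ≋-reflexive (sym (ℤ.+-identityʳ _))
    homotopy-refl .gaps _ = sym (ℤ.+-identityʳ _)

    homotopy-sym : ∀ {f g D} → Homotopy f g D → Homotopy g f (λ v → - D v)
    homotopy-sym {f} {g} {D} h .moved v = ≋-by (≋-sym (moved h v)) (eq ⟦ f v ⟧ ⟦ g v ⟧ (D v))
      where
      eq : ∀ a b d → (a + d) - b ≡ a - (b + - d)
      eq = solve-∀
    homotopy-sym {f} {g} {D} h .gaps {u} {v} u~v =
      trans (eq (gap (f u) (f v)) (D u) (D v)) (cong (_+ (- D v - - D u)) (sym (gaps h u~v)))
      where
      eq : ∀ a d e → a ≡ (a + (e - d)) + (- e - - d)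
      eq = solve-∀

    homotopy-trans : ∀ {f g k D D′} → Homotopy f g D → Homotopy g k D′ →
                     Homotopy f k (λ v → D v + D′ v)
    homotopy-trans {f} {g} {k} {D} {D′} h h′ .moved v =
      ≋-by₂ (moved h v) (moved h′ v) (eq ⟦ f v ⟧ ⟦ g v ⟧ ⟦ k v ⟧ (D v) (D′ v))
      where
      eq : ∀ a b c d e → (b - (a + d)) + (c - (b + e)) ≡ c - (a + (d + e))
      eq = solve-∀
    homotopy-trans {f} {D = D} {D′} h h′ .gaps {u} {v} u~v =
      trans (gaps h′ u~v) (trans (cong (_+ (D′ v - D′ u)) (gaps h u~v)) (eq (gap (f u) (f v)) (D u) (D v) (D′ u) (D′ v)))
      where
      eq : ∀ a d e d′ e′ → (a + (e - d)) + (e′ - d′) ≡ a + ((e + e′) - (d + d′))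
      eq = solve-∀

    -- Having a height function is thus a property of the homotopy class of a colouring.
    height-transport : ∀ {f g D E} → Homotopy f g D → Height f E → Height g (λ v → E v + + 2 * D v)
    height-transport {f} {g} {D} {E} h H .slope {u} {v} u~v =
      trans (eq₁ (E u) (E v) (D u) (D v))
        (trans (cong (_+ + 2 * (D v - D u)) (slope H u~v))
          (trans (eq₂ (gap (f u) (f v)) (D u) (D v) (+ p)) (cong (λ s → + 2 * s - + p) (sym (gaps h u~v)))))
      where
      eq₁ : ∀ E F d e → (F + + 2 * e) - (E + + 2 * d) ≡ (F - E) + + 2 * (e - d)
      eq₁ = solve-∀
      eq₂ : ∀ g d e p → (+ 2 * g - p) + + 2 * (e - d) ≡ + 2 * (g + (e - d)) - p
      eq₂ = solve-∀

    private
      reflectMap : Map → Map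
      reflectMap f v = reduce (- ⟦ f v ⟧)

      gap-reflect : (c : Colouring p q G) → ∀ {u v} → Adj G u v →
                    gap (reflectMap (proj₁ c) u) (reflectMap (proj₁ c) v) ≡ + p - gap (proj₁ c u) (proj₁ c v)
      gap-reflect c@(f , _) {u} {v} u~v = gap-unique (range-flip (gap-range c u~v))
        (≋-by₂ (≋-sym (≋-p (≋-neg (≋-sym (gap-≋ (f u) (f v)))))) (≋-sym (≋-- (reduce-≋ (- ⟦ f v ⟧)) (reduce-≋ (- ⟦ f u ⟧))))
          (eq (gap (f u) (f v)) ⟦ f u ⟧ ⟦ f v ⟧ ⟦ reflectMap f u ⟧ ⟦ reflectMap f v ⟧ (+ p)))
        where
        eq : ∀ g a b a′ b′ p → ((- g + p) - - (b - a)) + ((- b - - a) - (b′ - a′)) ≡ (p - g) - (b′ - a′)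
        eq = solve-∀

    reflect : Colouring p q G → Colouring p q G
    reflect c = reflectMap (proj₁ c) , λ u~v →
      gap-range⇒near (subst Range (sym (gap-reflect c u~v)) (range-flip (gap-range c u~v)))

    -- Reflection turns a gap g into p - g, so along an edge `D` changes by p - 2g, the negative of
    -- the required slope.
    reflect-height : ∀ c {D} → Homotopy (proj₁ c) (proj₁ (reflect c)) D → Height (proj₁ c) (λ v → - D v)
    reflect-height c@(f , _) {D} h .slope {u} {v} u~v =
      trans (eq₁ (D u) (D v) (gap (f u) (f v)))
        (trans (cong (λ s → gap (f u) (f v) - s) (trans (sym (gaps h u~v)) (gap-reflect c u~v)))
               (eq₂ (gap (f u) (f v)) (+ p)))
      where
      eq₁ : ∀ d e g → - e - - d ≡ g - (g + (e - d))
      eq₁ = solve-∀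
      eq₂ : ∀ g p → g - (p - g) ≡ + 2 * g - p
      eq₂ = solve-∀

    -- The displaced gaps are required to be in range as integers; hence they are the residues
    -- themselves and no edge wraps around.
    shift : (c : Colouring p q G) (Δ : Fin n → ℤ) →
            (∀ {u v} → Adj G u v → Range (gap (proj₁ c u) (proj₁ c v) + (Δ v - Δ u))) →
            Σ (Colouring p q G) λ c′ → Homotopy (proj₁ c) (proj₁ c′) Δ
    shift (f , _) Δ ok = (f′ , λ u~v → gap-range⇒near (subst Range (sym (gaps′ u~v)) (ok u~v))) ,
      homotopy moved′ gaps′
      where
      f′ : Map
      f′ v = reduce (⟦ f v ⟧ + Δ v)
      moved′ : ∀ v → ⟦ f′ v ⟧ ≋ ⟦ f v ⟧ + Δ v
      moved′ v = reduce-≋ (⟦ f v ⟧ + Δ v)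
      gaps′ : ∀ {u v} → Adj G u v → gap (f′ u) (f′ v) ≡ gap (f u) (f v) + (Δ v - Δ u)
      gaps′ {u} {v} u~v = gap-unique (ok u~v)
        (≋-trans (≋-sym (gap-+-≋ {d = Δ u} {Δ v} (moved′ u) (moved′ v))) (gap-≋ (f′ u) (f′ v)))

    moved-0 : ∀ {f g D v} → Homotopy f g D → D v ≡ 0ℤ → g v ≡ f v
    moved-0 {f} {g} {D} {v} h Dv≡0 = ⟦⟧-injective
      (≋-trans (moved h v) (≋-reflexive (trans (cong (λ d → ⟦ f v ⟧ + d) Dv≡0) (ℤ.+-identityʳ ⟦ f v ⟧))))

    recolour : (c : Colouring p q G) (v : Fin n) (e : ℤ) →
               (∀ {u} → Adj G u v → Range (gap (proj₁ c u) (proj₁ c v) + e)) →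
               Σ (Colouring p q G) λ c′ → Homotopy (proj₁ c) (proj₁ c′) (spike v e)
    recolour c@(f , _) v e ok = shift c (spike v e) ok′
      where
      eq₁ : ∀ g e → g + e ≡ g + (e - 0ℤ)
      eq₁ = solve-∀
      eq₂ : ∀ g e p → p - ((p - g) + e) ≡ g + (0ℤ - e)
      eq₂ = solve-∀
      ok′ : ∀ {u w} → Adj G u w → Range (gap (f u) (f w) + (spike v e w - spike v e u))
      ok′ {u} {w} u~w with w ≟ v | u ≟ v
      ... | yes refl | yes u≡v  = contradiction u~w (adj-irrefl G u≡v)
      ... | yes refl | no _     = subst Range (eq₁ (gap (f u) (f w)) e) (ok u~w)
      -- The hypothesis speaks of edges into `v`; an edge out of `v` is reversed, which replaces its
      -- gap by the complement to p.
      ... | no _     | yes refl = subst Range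
        (trans (cong (λ s → + p - (s + e)) (gap-flip (gap-range c u~w))) (eq₂ (gap (f u) (f w)) e (+ p)))
        (range-flip (ok (adj-sym G u~w)))
      ... | no _     | no _     = subst Range (sym (ℤ.+-identityʳ (gap (f u) (f w)))) (gap-range c u~w)

    spike-differ : ∀ {f g v e} → Homotopy f g (spike v e) → DifferAtMostOnce f g
    spike-differ {f} {g} {v} {e} h u w fu≢gu fw≢gw = trans (at fu≢gu) (sym (at fw≢gw))
      where
      at : ∀ {u} → f u ≢ g u → u ≡ v
      at {u} fu≢gu with u ≟ v
      ... | yes u≡v = u≡v
      ... | no u≢v  = contradiction (sym (moved-0 h (spike-off e u≢v))) fu≢gu

    -- v cannot be blocked by u: a gap p - q would put u strictly below v, so that D u ≤ 0,
    -- and then the gap in g would exceed p - q.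
    raise : ∀ (c : Colouring p q G) (g : Colouring p q G) {D E} →
            Homotopy (proj₁ c) (proj₁ g) D → Height (proj₁ c) E → ∃ (λ v → 0ℤ < D v) →
            Σ (Colouring p q G) λ c′ → ∃ λ v → Homotopy (proj₁ c) (proj₁ c′) (spike v 1ℤ) × 0ℤ < D v
    raise c@(f , _) (g , gcol) {D} {E} h H up with minimal (λ v → 0ℤ ℤ.<? D v) E up
    ... | v , 0<Dv , lowest = let c′ , h′ = recolour c v 1ℤ ok in c′ , v , h′ , 0<Dv
      where
      ok : ∀ {u} → Adj G u v → Range (gap (f u) (f v) + 1ℤ)
      ok {u} u~v = ≤-by₂ q≤s (+≤+ (ℕ.z≤n {1})) (eq s (+ q)) , hi
        where
        s = gap (f u) (f v)
        q≤s = proj₁ (gap-range c u~v)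
        eq : ∀ s q → (s - q) + (1ℤ - 0ℤ) ≡ (s + 1ℤ) - q
        eq = solve-∀
        hi : s + 1ℤ ≤ + p - + q
        hi with 0ℤ ℤ.<? D u
        ... | no Du≤0 = ≤-by₃ (subst (_≤ + p - + q) (gaps h u~v) (proj₂ (gap-range (g , gcol) u~v)))
                (ℤ.i<j⇒suc[i]≤j 0<Dv) (ℤ.≮⇒≥ Du≤0) (eq₁ s (D u) (D v) (+ p - + q))
          where
          eq₁ : ∀ s d e r → (r - (s + (e - d))) + (e - (1ℤ + 0ℤ)) + (0ℤ - d) ≡ r - (s + 1ℤ)
          eq₁ = solve-∀
        ... | yes 0<Du = subst (_≤ + p - + q) (ℤ.+-comm 1ℤ s) (halve-< {s}
                (≤-by₂ 1+2q≤p (subst (_≤ 0ℤ) (slope H u~v) (ℤ.i≤j⇒i-j≤0 (lowest u 0<Du))) (eq₂ s (+ p) (+ q))))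
          where
          eq₂ : ∀ s p q → (p - (1ℤ + + 2 * q)) + (0ℤ - (+ 2 * s - p)) ≡ + 2 * (p - q) - (1ℤ + + 2 * s)
          eq₂ = solve-∀

    -- Induction on the sum of the absolute displacements, which each unit move lowers. A positive
    -- displacement allows a move starting at `c`, a negative one a move ending at `d`.
    connect : (c d : Colouring p q G) → ∀ {D E} → Homotopy (proj₁ c) (proj₁ d) D → Height (proj₁ c) E →
              Star (DifferAtMostOnce on proj₁) c d
    connect c d h H = go c d h H (<-wellFounded _)
      where
      size : (Fin n → ℤ) → ℕ
      size D = sum λ v → ∣ D v ∣

      lowered : ∀ {x} → 0ℤ < x → ∣ - 1ℤ + x ∣ ℕ.< ∣ x ∣
      lowered {+ ℕ.suc x} (+<+ _) = ℕ.≤-refl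

      shrinks : ∀ D v → 0ℤ < D v → size (λ w → - spike v 1ℤ w + D w) ℕ.< size D
      shrinks D v 0<Dv = sum-mono-< weak v (subst (λ s → ∣ - s + D v ∣ ℕ.< ∣ D v ∣) (sym (spike-at v 1ℤ)) (lowered 0<Dv))
        where
        weak : ∀ w → ∣ - spike v 1ℤ w + D w ∣ ℕ.≤ ∣ D w ∣
        weak w with w ≟ v
        ... | yes refl = ℕ.<⇒≤ (lowered 0<Dv)
        ... | no _     = ℕ.≤-reflexive (cong ∣_∣ (ℤ.+-identityˡ (D w)))

      size-neg : ∀ D → size (λ v → - D v) ≡ size D
      size-neg D = sum-cong-≗ (ℤ.∣-i∣≡∣i∣ ∘ D)

      go : ∀ c d {D E} → Homotopy (proj₁ c) (proj₁ d) D → Height (proj₁ c) E → Acc ℕ._<_ (size D) →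
           Star (DifferAtMostOnce on proj₁) c d
      go c d {D} {E} h H (acc rec) with any? (λ v → 0ℤ ℤ.<? D v)
      ... | yes up =
        let c′ , v , h′ , 0<Dv = raise c d h H up in
        spike-differ h′ ◅ go c′ d (homotopy-trans (homotopy-sym h′) h) (height-transport h′ H) (rec (shrinks D v 0<Dv))
      ... | no ¬up with any? (λ v → 0ℤ ℤ.<? - D v)
      ...   | yes down =
        -- Now `d` is raised towards `c`, along the reversed homotopy and with the height function
        -- carried over to `d`.
        let d′ , v , h′ , 0<Dv = raise d c (homotopy-sym h) (height-transport h H) down in
        go c d′ (homotopy-trans h h′) H
          (rec (subst (ℕ._< size D)
                 (trans (sym (size-neg (λ w → - spike v 1ℤ w + - D w)))
                   (sum-cong-≗ λ w → cong ∣_∣ (eq (D w) (spike v 1ℤ w))))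
                 (subst (size (λ w → - spike v 1ℤ w + - D w) ℕ.<_) (size-neg D) (shrinks (λ w → - D w) v 0<Dv))))
          ◅◅ (differ-sym (spike-differ h′) ◅ ε)
        where
        eq : ∀ d s → - (- s + - d) ≡ d + s
        eq = solve-∀
      -- No vertex is displaced, so the colourings agree pointwise; one trivial step joins them
      -- without their being equal as pairs.
      ...   | no ¬down = (λ u _ fu≢gu _ → contradiction (sym (moved-0 h (still u))) fu≢gu) ◅ ε
        where
        still : ∀ v → D v ≡ 0ℤ
        still v = ℤ.≤-antisym (ℤ.≮⇒≥ λ 0<Dv → ¬up (v , 0<Dv))
          (subst (0ℤ ≤_) (ℤ.neg-involutive (D v)) (ℤ.neg-mono-≤ (ℤ.≮⇒≥ λ 0<-Dv → ¬down (v , 0<-Dv))))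

-- The quotient map of a fold, and transport of colourings along homomorphisms.

module _ {n} {x y : Fin (ℕ.suc n)} (y≢x : y ≢ x) where

  merge-x≡y : merge x y y≢x x ≡ merge x y y≢x y
  merge-x≡y with y ≟ x | y ≟ y
  ... | yes y≡x | _       = contradiction y≡x y≢x
  ... | no _    | yes _   = refl
  ... | no _    | no y≢y  = contradiction refl y≢y

  -- The vertices of the quotient stand for those other than `y`, so a function that agrees on `x`
  -- and `y` descends by composition with the section `punchIn y`.
  merge-factor : {A : Set} (f : Fin (ℕ.suc n) → A) → f y ≡ f x →
                 ∀ v → f (punchIn y (merge x y y≢x v)) ≡ f v
  merge-factor f fy≡fx v with y ≟ v
  ... | yes refl = trans (cong f (punchIn-punchOut y≢x)) (sym fy≡fx)
  ... | no y≢v   = cong f (punchIn-punchOut y≢v)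

  merge-punchIn : ∀ v → merge x y y≢x (punchIn y v) ≡ v
  merge-punchIn v with y ≟ punchIn y v
  ... | yes y≡in = contradiction (sym y≡in) (punchInᵢ≢i y v)
  ... | no y≢in  = punchIn-injective y _ _ (punchIn-punchOut y≢in)

distance-2⇒common : ∀ {n} {G : Graph n} {x y} → Distance G x y 2 → ∃ λ w → Adj G x w × Adj G w y
distance-2⇒common (x~w ∷ (w~y ∷ []) , _) = _ , x~w , w~y

distance-2⇒≢ : ∀ {n} {G : Graph n} {x y} → Distance G x y 2 → y ≢ x
distance-2⇒≢ (_ , far) refl = far 0 (ℕ.s≤s ℕ.z≤n) []

pullback : ∀ {p q m n} {G : Graph m} {H : Graph n} → Hom G H → Colouring p q H → Colouring p q G
pullback (hom φ φ-pres) (f , col) = f ∘ φ , col ∘ φ-pres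

isoHom : ∀ {m n} {G : Graph m} {H : Graph n} → G ≅ H → Hom G H
isoHom (φ , adj⇔) = hom (Inverse.to φ) (Equivalence.to (adj⇔ _ _))

isoHom⁻¹ : ∀ {m n} {G : Graph m} {H : Graph n} → G ≅ H → Hom H G
isoHom⁻¹ {H = H} (φ , adj⇔) = hom (Inverse.from φ) λ {u} {v} u~v →
  Equivalence.from (adj⇔ _ _) (subst₂ (Adj H) (sym (Inverse.strictlyInverseˡ φ u)) (sym (Inverse.strictlyInverseˡ φ v)) u~v)

-- A round trip through the isomorphism returns a colouring that is only pointwise equal to the
-- original, hence one extra step at each end.
mixing-≅ : ∀ {p q m n} {G : Graph m} {H : Graph n} → G ≅ H → Mixing p q G → Mixing p q H
mixing-≅ {p} {q} {G = G} {H} iso@(φ , _) mixing c d =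
  same c ◅ (transfer (mixing (to c) (to d)) ◅◅ (back d ◅ ε))
  where
  open Inverse φ using (from; strictlyInverseˡ; strictlyInverseʳ)
  to : Colouring p q H → Colouring p q G
  to = pullback {p} {q} (isoHom {G = G} {H} iso)
  from′ : Colouring p q G → Colouring p q H
  from′ = pullback {p} {q} (isoHom⁻¹ {G = G} {H} iso)
  same : (c : Colouring p q H) → DifferAtMostOnce (proj₁ c) (proj₁ (from′ (to c)))
  same (f , _) u _ f≢ _ = contradiction (cong f (sym (strictlyInverseˡ u))) f≢
  back : (c : Colouring p q H) → DifferAtMostOnce (proj₁ (from′ (to c))) (proj₁ c)
  back c = differ-sym (same c)
  from-injective : ∀ {u v} → from u ≡ from v → u ≡ v
  from-injective {u} {v} eq = trans (sym (strictlyInverseˡ u)) (trans (cong (Inverse.to φ) eq) (strictlyInverseˡ v))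
  transfer : ∀ {c d} → Star (DifferAtMostOnce on proj₁) c d → Star (DifferAtMostOnce on proj₁) (from′ c) (from′ d)
  transfer ε = ε
  transfer (once ◅ rest) =
    (λ u v fu≢gu fv≢gv → from-injective (once (from u) (from v) fu≢gu fv≢gv)) ◅ transfer rest

-- Mixing yields height functions and is inherited by folds.

module Folding (p q : ℕ) .{{_ : NonZero p}} .{{_ : NonZero q}}
  (2q<p : 2 ℕ.* q ℕ.< p) (p<4q : p ℕ.< 4 ℕ.* q) where

  open import Data.Integer.Base using (+_; _+_; _*_; _-_; -_; _≤_; +≤+)

  open Circular p q 2q<p

  private
    1+p≤4q : 1ℤ + + p ≤ + 4 * + q
    1+p≤4q = subst (1ℤ + + p ≤_) (ℤ.pos-* 4 q) (+≤+ p<4q)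

  -- Both t - s and d have absolute value at most p/2, the former strictly, by p < 4q.
  range-jump : ∀ {s t d} → Range s → Range t → - + p ≤ + 2 * d → + 2 * d ≤ + p → t ≋ s + d → t ≡ s + d
  range-jump {s} {t} {d} (q≤s , s≤p-q) (q≤t , t≤p-q) -p≤2d 2d≤p t≋s+d = ≋-small t≋s+d
    (halve-< {t - (s + d)} (≤-by₃ (spread q≤s t≤p-q) -p≤2d 1+p≤4q (eq₁ s t d (+ p) (+ q))))
    (halve-< {s + d - t} (≤-by₃ (spread q≤t s≤p-q) 2d≤p 1+p≤4q (eq₂ s t d (+ p) (+ q))))
    where
    spread : ∀ {s t} → + q ≤ s → t ≤ + p - + q → + 2 * (t - s) ≤ + 2 * (+ p - + q - + q)
    spread {s} {t} q≤s t≤p-q = ℤ.*-monoˡ-≤-nonNeg (+ 2) (≤-by₂ q≤s t≤p-q (eq s t (+ p) (+ q)))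
      where
      eq : ∀ s t p q → (s - q) + ((p - q) - t) ≡ (p - q - q) - (t - s)
      eq = solve-∀
    eq₁ : ∀ s t d p q → (+ 2 * (p - q - q) - + 2 * (t - s)) + (+ 2 * d - - p) + (+ 4 * q - (1ℤ + p)) ≡
                        + 2 * p - (1ℤ + + 2 * (t - (s + d)))
    eq₁ = solve-∀
    eq₂ : ∀ s t d p q → (+ 2 * (p - q - q) - + 2 * (s - t)) + (p - + 2 * d) + (+ 4 * q - (1ℤ + p)) ≡
                        + 2 * p - (1ℤ + + 2 * (s + d - t))
    eq₂ = solve-∀

  module _ {n} (G : Graph n) where

    -- The moved vertex is displaced by the centred difference of its colours, all others by 0. Then
    -- `range-jump` upgrades the congruence of gaps on each edge to an equality.
    step-homotopy : (c d : Colouring p q G) → DifferAtMostOnce (proj₁ c) (proj₁ d) →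
                    ∃ (Homotopy G (proj₁ c) (proj₁ d))
    step-homotopy c@(f , _) d@(g , _) once = D , homotopy moved′ λ {u} {v} u~v → gaps′ u v u~v
      where
      jump : ∀ v → ∃ λ d → d ≋ ⟦ g v ⟧ - ⟦ f v ⟧ × - + p ≤ + 2 * d × + 2 * d ≤ + p
      jump v with f v ≟ g v
      ... | yes fv≡gv = 0ℤ , ≋-reflexive (sym (ℤ.i≡j⇒i-j≡0 (cong ⟦_⟧ (sym fv≡gv)))) ,
                        ℤ.neg-mono-≤ (+≤+ (ℕ.z≤n {p})) , +≤+ ℕ.z≤n
      ... | no _      = centred (⟦ g v ⟧ - ⟦ f v ⟧)
      D : Fin n → ℤ
      D v = proj₁ (jump v)
      moved′ : ∀ v → ⟦ g v ⟧ ≋ ⟦ f v ⟧ + D v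
      moved′ v = ≋-by (≋-sym (proj₁ (proj₂ (jump v)))) (eq (⟦ f v ⟧) (⟦ g v ⟧) (D v))
        where
        eq : ∀ a b d → (b - a) - d ≡ b - (a + d)
        eq = solve-∀
      D≡0 : ∀ {v} → f v ≡ g v → D v ≡ 0ℤ
      D≡0 {v} fv≡gv with f v ≟ g v
      ... | yes _     = refl
      ... | no fv≢gv = contradiction fv≡gv fv≢gv
      -- The ends of an edge are distinct, so at most one of them moves and the difference is, up to
      -- sign, a single centred displacement.
      bounds : ∀ {u v} → Adj G u v → - + p ≤ + 2 * (D v - D u) × + 2 * (D v - D u) ≤ + p
      bounds {u} {v} u~v = go (f u ≟ g u) (f v ≟ g v)
        where
        go : Dec (f u ≡ g u) → Dec (f v ≡ g v) → - + p ≤ + 2 * (D v - D u) × + 2 * (D v - D u) ≤ + p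
        go (yes fu≡gu) _ = subst Bounded
          (trans (sym (ℤ.+-identityʳ (D v))) (cong (λ d → D v - d) (sym (D≡0 fu≡gu)))) (proj₂ (proj₂ (jump v)))
          where
          Bounded = λ d → - + p ≤ + 2 * d × + 2 * d ≤ + p
        go (no _) (yes fv≡gv) =
          subst (- + p ≤_) (eq (D u) (D v) (D≡0 fv≡gv)) (ℤ.neg-mono-≤ (proj₂ (proj₂ (proj₂ (jump u))))) ,
          subst₂ _≤_ (eq (D u) (D v) (D≡0 fv≡gv)) (ℤ.neg-involutive (+ p)) (ℤ.neg-mono-≤ (proj₁ (proj₂ (proj₂ (jump u)))))
          where
          eq′ : ∀ d → - (+ 2 * d) ≡ + 2 * (0ℤ - d)
          eq′ = solve-∀
          eq : ∀ d e → e ≡ 0ℤ → - (+ 2 * d) ≡ + 2 * (e - d)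
          eq d _ refl = eq′ d
        go (no fu≢gu) (no fv≢gv) = contradiction u~v (adj-irrefl G (once u v fu≢gu fv≢gv))
      gaps′ : ∀ u v → Adj G u v → gap (g u) (g v) ≡ gap (f u) (f v) + (D v - D u)
      gaps′ u v u~v = let lo , hi = bounds u~v in
        range-jump (gap-range G c u~v) (gap-range G d u~v) lo hi (gap-+-≋ {d = D u} {D v} (moved′ u) (moved′ v))

    star-homotopy : ∀ {c d : Colouring p q G} → Star (DifferAtMostOnce on proj₁) c d →
                    ∃ (Homotopy G (proj₁ c) (proj₁ d))
    star-homotopy ε = _ , homotopy-refl G
    star-homotopy {c} (_◅_ {j = c′} once rest) =
      _ , homotopy-trans G (proj₂ (step-homotopy c c′ once)) (proj₂ (star-homotopy rest))

    -- Mixing is applied to a colouring and its reflection.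
    mixing⇒height : Mixing p q G → (c : Colouring p q G) → ∃ (Height G (proj₁ c))
    mixing⇒height mixing c = _ , reflect-height G c (proj₂ (star-homotopy (mixing c (reflect G c))))

  -- Seen from the common neighbour `w`, the gaps to `x` and `y` agree before and after, so their
  -- changes agree too.
  identical-steps : ∀ {n} {G : Graph n} {f g D w x y} → Homotopy G f g D → Adj G w x → Adj G w y →
                    f x ≡ f y → g x ≡ g y → D x ≡ D y
  identical-steps {f = f} {g} {D} {w} {x} {y} h w~x w~y fx≡fy gx≡gy =
    trans (eq (gap (f w) (f x)) (D w) (D x)) (trans (cong₂ (λ s t → t - s + D w) (cong (gap (f w)) fx≡fy)
      (trans (sym (gaps h w~x)) (trans (cong (gap (g w)) gx≡gy) (gaps h w~y))))
      (sym (eq (gap (f w) (f y)) (D w) (D y))))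
    where
    eq : ∀ s d e → e ≡ (s + (e - d)) - s + d
    eq = solve-∀

  identical-heights : ∀ {n} {G : Graph n} {f E w x y} → Height G f E → Adj G w x → Adj G w y →
                      f x ≡ f y → E x ≡ E y
  identical-heights {f = f} {E} {w} {x} {y} e w~x w~y fx≡fy =
    trans (eq (E w) (E x))
      (trans (cong (_+ E w) (trans (slope e w~x) (trans (cong (λ a → + 2 * gap (f w) a - + p) fx≡fy) (sym (slope e w~y)))))
        (sym (eq (E w) (E y))))
    where
    eq : ∀ a b → b ≡ (b - a) + a
    eq = solve-∀

  module _ {n} (G : Graph (ℕ.suc n)) (x y : Fin (ℕ.suc n)) (dist2 : Distance G x y 2) where

    private
      K = identify G x y dist2
      y≢x = distance-2⇒≢ dist2

    -- A sequence of recolourings in `G` may separate `x` and `y` on its way, so it cannot be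
    -- projected to the quotient. Its homotopy and the height function do descend, since the lifted
    -- colourings agree on `x` and `y`, and `connect` makes a new sequence from them.
    mixing-identify : Mixing p q G → Mixing p q K
    mixing-identify mixing c@(f , _) d@(g , _) = connect K c d H EH
      where
      π = foldMap G x y dist2
      πx≡πy = merge-x≡y y≢x
      w = proj₁ (distance-2⇒common dist2)
      x~w = proj₁ (proj₂ (distance-2⇒common dist2))
      w~y = proj₂ (proj₂ (distance-2⇒common dist2))
      lift : Colouring p q K → Colouring p q G
      lift = pullback {p} {q} (elementaryFold G x y dist2)
      D,h = star-homotopy G (mixing (lift c) (lift d))
      D = proj₁ D,h
      h = proj₂ D,h
      E,e = mixing⇒height G mixing (lift c)
      E = proj₁ E,e
      e = proj₂ E,e
      Dy≡Dx : D y ≡ D x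
      Dy≡Dx = sym (identical-steps h (adj-sym G x~w) w~y (cong f πx≡πy) (cong g πx≡πy))
      Ey≡Ex : E y ≡ E x
      Ey≡Ex = sym (identical-heights e (adj-sym G x~w) w~y (cong f πx≡πy))
      H : Homotopy K f g (D ∘ punchIn y)
      H .moved a = subst (λ b → ⟦ g b ⟧ ≋ ⟦ f b ⟧ + D (punchIn y a)) (merge-punchIn y≢x a) (moved h (punchIn y a))
      H .gaps (u , v , refl , refl , u~v) = trans (gaps h u~v)
        (cong₂ (λ d e → gap (f (π u)) (f (π v)) + (e - d))
          (sym (merge-factor y≢x D Dy≡Dx u)) (sym (merge-factor y≢x D Dy≡Dx v)))
      EH : Height K f (E ∘ punchIn y)
      EH .slope (u , v , refl , refl , u~v) = trans
        (cong₂ (λ d e → e - d) (merge-factor y≢x E Ey≡Ex u) (merge-factor y≢x E Ey≡Ex v))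
        (slope e u~v)

  mixing-fold : ∀ {m n} {G : Graph m} {K : Graph n} {f : Hom G K} → FoldComposition f → Mixing p q G → Mixing p q K
  mixing-fold none = λ mixing → mixing
  mixing-fold (step x y dist2 folds) = mixing-fold folds ∘ mixing-identify _ x y dist2

  mixing-folds-to : ∀ {m n} {G : Graph m} {H : Graph n} → G FoldsTo H → Mixing p q G → Mixing p q H
  mixing-folds-to {H = H} (_ , K , _ , folds , iso) mixing = mixing-≅ {p} {q} {G = K} {H} iso (mixing-fold folds mixing)

-- Walks, and cyclic orders from orbits of an injection.

walk-map : ∀ {m n} {G : Graph m} {H : Graph n} (φ : Hom G H) → ∀ {k u v} → Walk G k u v →
           Walk H k (Hom.map φ u) (Hom.map φ v)
walk-map φ []       = []
walk-map φ (e ∷ es) = Hom.preserve φ e ∷ walk-map φ es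

walk-closed : ∀ {n} {G : Graph n} {P : Fin n → Set} → (∀ {u v} → Adj G u v → P u → P v) →
              ∀ {k u v} → Walk G k u v → P u → P v
walk-closed closed []       = id
walk-closed closed (e ∷ es) = walk-closed closed es ∘ closed e

≢-both⇒≡ : ∀ {a b c : Bool} → a ≢ c → b ≢ c → a ≡ b
≢-both⇒≡ a≢c b≢c = trans (¬-not a≢c) (sym (¬-not b≢c))

least : ∀ {P : ℕ → Set} → Decidable P → ∀ d → P d → ∃ λ m → P m × (∀ j → j ℕ.< m → ¬ P j)
least P? d Pd with P? 0
... | yes P0 = 0 , P0 , λ _ ()
least P? ℕ.zero Pd | no ¬P0 = contradiction Pd ¬P0
least P? (ℕ.suc d) Pd | no ¬P0 with least (P? ∘ ℕ.suc) d Pd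
... | m , Pm , below = ℕ.suc m , Pm , λ where
  ℕ.zero    _           → ¬P0
  (ℕ.suc j) (ℕ.s≤s j<m) → below j j<m

-- `N` runs through all vertices in a single cycle, and `index` is the position counted from
-- `start`. Storing `last` makes the period visibly positive.
record CyclicOrder {n} (N : Fin n → Fin n) : Set where
  field
    start : Fin n
    last  : ℕ

  orbit : ℕ → Fin n
  orbit = fold start N

  period : ℕ
  period = ℕ.suc last

  field
    orbit-period : orbit period ≡ start
    index        : Fin n → ℕ
    index<period : ∀ v → index v ℕ.< period
    orbit-index  : ∀ v → orbit (index v) ≡ v
    index-orbit  : ∀ {i} → i ℕ.< period → index (orbit i) ≡ i

  -- The relation `Successor` of a cycle of length `period`, on natural numbers.
  Next : ℕ → ℕ → Set
  Next i j = j ≡ ℕ.suc i ⊎ (ℕ.suc i ≡ period × j ≡ 0)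

  index-next : ∀ v → Next (index v) (index (N v))
  index-next v with ℕ.suc (index v) ℕ.<? period
  ... | yes 1+i<k = inj₁ (trans (cong (index ∘ N) (sym (orbit-index v))) (index-orbit 1+i<k))
  ... | no 1+i≮k  = inj₂ (1+i≡k ,
    trans (cong (index ∘ N) (sym (orbit-index v)))
      (trans (cong index (trans (cong orbit 1+i≡k) orbit-period)) (index-orbit (ℕ.s≤s ℕ.z≤n))))
    where
    1+i≡k = ℕ.≤-antisym (index<period v) (ℕ.≮⇒≥ 1+i≮k)

  next-index : ∀ {u v} → Next (index u) (index v) → N u ≡ v
  next-index {u} {v} (inj₁ eq) =
    trans (cong N (sym (orbit-index u))) (trans (cong orbit (sym eq)) (orbit-index v))
  next-index {u} {v} (inj₂ (1+i≡k , j≡0)) =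
    trans (cong N (sym (orbit-index u)))
      (trans (cong orbit 1+i≡k) (trans orbit-period (trans (cong orbit (sym j≡0)) (orbit-index v))))

  orbit-injective : ∀ {i j} → i ℕ.< period → j ℕ.< period → orbit i ≡ orbit j → i ≡ j
  orbit-injective i<k j<k eq = trans (sym (index-orbit i<k)) (trans (cong index eq) (index-orbit j<k))

module Orbit {n} (N : Fin n → Fin n) (N-injective : Injective _≡_ _≡_ N) (v₀ : Fin n) where

  private
    orbit : ℕ → Fin n
    orbit = fold v₀ N

  private
    cancel : ∀ i {d} → orbit i ≡ orbit (i ℕ.+ d) → v₀ ≡ orbit d
    cancel ℕ.zero    eq = eq
    cancel (ℕ.suc i) eq = cancel i (N-injective eq)

    meet : ∀ {i j} → i ℕ.< j → orbit i ≡ orbit j → ∃ λ d → v₀ ≡ orbit (ℕ.suc d) × d ℕ.< j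
    meet {i} {j} i<j eq with ℕ.m≤n⇒∃[o]m+o≡n i<j
    ... | d , refl = d , cancel i (trans eq (cong orbit (sym (ℕ.+-suc i d)))) , ℕ.s≤s (ℕ.m≤n+m d i)

    -- The pigeonhole principle gives a repetition, and injectivity of `N` cancels its initial part.
    return : ∃ λ d → v₀ ≡ orbit (ℕ.suc d)
    return with pigeonhole (ℕ.n<1+n n) (orbit ∘ toℕ)
    ... | _ , _ , i<j , eq = let d , v₀≡ , _ = meet i<j eq in d , v₀≡

    -- The search starts at one application of `N`, since zero applications return trivially.
    first : ∃ λ m → v₀ ≡ orbit (ℕ.suc m) × (∀ j → j ℕ.< m → v₀ ≢ orbit (ℕ.suc j))
    first = least (λ d → v₀ ≟ orbit (ℕ.suc d)) (proj₁ return) (proj₂ return)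

    last period : ℕ
    last = proj₁ first
    period = ℕ.suc last

    orbit-period : orbit period ≡ v₀
    orbit-period = sym (proj₁ (proj₂ first))

    orbit-< : ∀ {i j} → i ℕ.< j → j ℕ.< period → orbit i ≢ orbit j
    orbit-< i<j (ℕ.s≤s j≤last) eq with meet i<j eq
    ... | d , v₀≡ , d<j = proj₂ (proj₂ first) d (ℕ.≤-trans d<j j≤last) v₀≡

    orbit-injective : ∀ {i j} → i ℕ.< period → j ℕ.< period → orbit i ≡ orbit j → i ≡ j
    orbit-injective {i} {j} i<k j<k eq with ℕ.<-cmp i j
    ... | tri< i<j _ _ = contradiction eq (orbit-< i<j j<k)
    ... | tri≈ _ i≡j _ = i≡j
    ... | tri> _ _ j<i = contradiction (sym eq) (orbit-< j<i i<k)

  OnOrbit : Fin n → Set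
  OnOrbit v = ∃ λ i → i ℕ.< period × orbit i ≡ v

  onOrbit-start : OnOrbit v₀
  onOrbit-start = 0 , ℕ.s≤s ℕ.z≤n , refl

  onOrbit-next : ∀ {v} → OnOrbit v → OnOrbit (N v)
  onOrbit-next (i , i<k , refl) with ℕ.suc i ℕ.<? period
  ... | yes 1+i<k = ℕ.suc i , 1+i<k , refl
  ... | no 1+i≮k  = 0 , ℕ.s≤s ℕ.z≤n , trans (sym orbit-period) (cong orbit (ℕ.≤-antisym (ℕ.≮⇒≥ 1+i≮k) i<k))

  onOrbit-previous : ∀ {v} → OnOrbit (N v) → OnOrbit v
  onOrbit-previous (ℕ.zero  , _   , eq) = last , ℕ.n<1+n last , N-injective (trans orbit-period eq)
  onOrbit-previous (ℕ.suc i , i<k , eq) = i , ℕ.<-trans (ℕ.n<1+n i) i<k , N-injective eq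

  cyclicOrder : (∀ v → OnOrbit v) → CyclicOrder N
  cyclicOrder onOrbit = record
    { start        = v₀
    ; last         = last
    ; orbit-period = orbit-period
    ; index        = proj₁ ∘ onOrbit
    ; index<period = proj₁ ∘ proj₂ ∘ onOrbit
    ; orbit-index  = proj₂ ∘ proj₂ ∘ onOrbit
    ; index-orbit  = λ i<k → orbit-injective (proj₁ (proj₂ (onOrbit _))) i<k (proj₂ (proj₂ (onOrbit _)))
    }

-- Colourings of a connected graph with height functions are homotopic.

module Connecting (p q : ℕ) .{{_ : NonZero p}} .{{_ : NonZero q}} (2q<p : 2 ℕ.* q ℕ.< p) where

  open import Data.Integer.Base using (+_; _+_; _*_; _-_; -_)

  open Circular p q 2q<p

  -- The displacement is accumulated along a walk from `zero`. The last component of `Transport`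
  -- expresses its double by the two heights, so the choice of walk does not matter.
  heights⇒homotopy : ∀ {n} (G : Graph n) → Connected G → ∀ {f g E F} →
                     Height G f E → Height G g F → ∃ (Homotopy G f g)
  heights⇒homotopy {ℕ.zero} G conn hE hF = (λ ()) , homotopy (λ ()) λ {}
  heights⇒homotopy {ℕ.suc n} G conn {f} {g} {E} {F} hE hF =
    D , homotopy (proj₁ ∘ proj₂ ∘ from-base) λ {u} {v} u~v → gaps′ u v u~v
    where
    d₀ = ⟦ g zero ⟧ - ⟦ f zero ⟧
    -- The constant that makes the invariant true at the base vertex.
    k = + 2 * d₀ - (F zero - E zero)
    Transport : Fin (ℕ.suc n) → Set
    Transport v = ∃ λ d → (⟦ g v ⟧ ≋ ⟦ f v ⟧ + d) × (+ 2 * d ≡ (F v - E v) + k)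
    base : Transport zero
    base = d₀ , ≋-reflexive (eq₁ (⟦ f zero ⟧) (⟦ g zero ⟧)) , eq₂ d₀ (F zero - E zero)
      where
      eq₁ : ∀ a b → b ≡ a + (b - a)
      eq₁ = solve-∀
      eq₂ : ∀ d s → + 2 * d ≡ s + (+ 2 * d - s)
      eq₂ = solve-∀
    extend : ∀ {u v} → Adj G u v → Transport u → Transport v
    extend {u} {v} u~v (d , gu≋ , 2d≡) =
      d + (gap (g u) (g v) - gap (f u) (f v)) ,
      ≋-by₂ gu≋ (≋-- (≋-sym (gap-≋ (g u) (g v))) (≋-sym (gap-≋ (f u) (f v))))
        (eq₁ (⟦ f u ⟧) (⟦ f v ⟧) (⟦ g u ⟧) (⟦ g v ⟧) (gap (f u) (f v)) (gap (g u) (g v)) d) ,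
      trans (eq₂ d (gap (g u) (g v)) (gap (f u) (f v)) (+ p))
        (trans (cong₂ _+_ 2d≡ (cong₂ _-_ (sym (slope hF u~v)) (sym (slope hE u~v))))
          (eq₃ (E u) (E v) (F u) (F v) k))
      where
      eq₁ : ∀ a b a′ b′ s s′ d → (a′ - (a + d)) + (((b′ - a′) - (b - a)) - (s′ - s)) ≡ b′ - (b + (d + (s′ - s)))
      eq₁ = solve-∀
      eq₂ : ∀ d s′ s p → + 2 * (d + (s′ - s)) ≡ + 2 * d + ((+ 2 * s′ - p) - (+ 2 * s - p))
      eq₂ = solve-∀
      eq₃ : ∀ e e′ f f′ k → (f - e) + k + ((f′ - f) - (e′ - e)) ≡ (f′ - e′) + k
      eq₃ = solve-∀
    from-base : ∀ v → Transport v
    from-base v = walk-closed extend (proj₂ (conn zero v)) base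
    D : Fin (ℕ.suc n) → ℤ
    D = proj₁ ∘ from-base
    gaps′ : ∀ u v → Adj G u v → gap (g u) (g v) ≡ gap (f u) (f v) + (D v - D u)
    -- Twice the equation results from the slopes of `E` and `F` and the invariant at both ends.
    gaps′ u v u~v = halve-≡ (trans (eq₁ (gap (g u) (g v)) (+ p)) (trans (cong (_+ + p) (sym (slope hF u~v)))
      (trans (eq₂ (E u) (E v) (F u) (F v) k (+ p))
        (trans (cong₂ (λ s d → s + d + + p) (slope hE u~v)
                 (cong₂ _-_ (sym (proj₂ (proj₂ (from-base v)))) (sym (proj₂ (proj₂ (from-base u))))))
          (eq₃ (gap (f u) (f v)) (D u) (D v) (+ p))))))
      where
      eq₁ : ∀ s p → + 2 * s ≡ (+ 2 * s - p) + p
      eq₁ = solve-∀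
      eq₂ : ∀ e e′ f f′ k p → (f′ - f) + p ≡ (e′ - e) + ((f′ - e′ + k) - (f - e + k)) + p
      eq₂ = solve-∀
      eq₃ : ∀ s d e p → (+ 2 * s - p) + (+ 2 * e - + 2 * d) + p ≡ + 2 * (s + (e - d))
      eq₃ = solve-∀

-- The case p = 2q + 1: folding to the cycle or having a height function.

module OddCycle (p q : ℕ) .{{_ : NonZero p}} .{{_ : NonZero q}}
  (2q<p : 2 ℕ.* q ℕ.< p) (p≡2q+1 : p ≡ 2 ℕ.* q ℕ.+ 1) where

  open import Data.Integer.Base using (+_; _+_; _*_; _-_; -_; _≤_; _<_; +≤+)

  open Circular p q 2q<p

  C : Graph (4 ℕ.* q ℕ.+ 2)
  C = cycle (4 ℕ.* q ℕ.+ 2) (3≤4q+2 q)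

  private
    -- Only the gaps q and q + 1 are in range; they have slopes -1 and 1.
    ↑ : ℤ
    ↑ = 1ℤ + + q

    p≡ : + p ≡ + 2 * + q + 1ℤ
    p≡ = trans (cong +_ p≡2q+1) (cong (_+ 1ℤ) (ℤ.pos-* 2 q))

    p-q≡↑ : + p - + q ≡ ↑
    p-q≡↑ = trans (cong (_- + q) p≡) (eq (+ q))
      where
      eq : ∀ q → (+ 2 * q + 1ℤ) - q ≡ 1ℤ + q
      eq = solve-∀

    p-↑≡q : + p - ↑ ≡ + q
    p-↑≡q = trans (cong (_- ↑) p≡) (eq (+ q))
      where
      eq : ∀ q → (+ 2 * q + 1ℤ) - (1ℤ + q) ≡ q
      eq = solve-∀

    q<↑ : + q < ↑
    q<↑ = ℤ.suc[i]≤j⇒i<j ℤ.≤-refl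

    range-↑ : Range ↑
    range-↑ = ℤ.<⇒≤ q<↑ , ℤ.≤-reflexive (sym p-q≡↑)

    range-q : Range (+ q)
    range-q = ℤ.≤-refl , ℤ.≤-trans (ℤ.<⇒≤ q<↑) (ℤ.≤-reflexive (sym p-q≡↑))

    range-cases : ∀ {s} → Range s → s ≡ + q ⊎ s ≡ ↑
    range-cases {s} (q≤s , s≤p-q) with s ℤ.≟ + q
    ... | yes s≡q = inj₁ s≡q
    ... | no s≢q  = inj₂ (ℤ.≤-antisym (ℤ.≤-trans s≤p-q (ℤ.≤-reflexive p-q≡↑)) (ℤ.i<j⇒suc[i]≤j (ℤ.≤∧≢⇒< q≤s (s≢q ∘ sym))))

    2↑-p≡1 : + 2 * ↑ - + p ≡ 1ℤ
    2↑-p≡1 = trans (cong (λ r → + 2 * ↑ - r) p≡) (eq (+ q))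
      where
      eq : ∀ q → + 2 * (1ℤ + q) - (+ 2 * q + 1ℤ) ≡ 1ℤ
      eq = solve-∀

    2q-p≡-1 : + 2 * + q - + p ≡ - 1ℤ
    2q-p≡-1 = trans (cong (λ r → + 2 * + q - r) p≡) (eq (+ q))
      where
      eq : ∀ q → + 2 * q - (+ 2 * q + 1ℤ) ≡ - 1ℤ
      eq = solve-∀

    p≋0 : + p ≋ 0ℤ
    p≋0 = mod (divides 1ℤ (eq (+ p)))
      where
      eq : ∀ p → p - 0ℤ ≡ 1ℤ * p
      eq = solve-∀

    ≋-*ˡ : ∀ k {x y} → x ≋ y → k * x ≋ k * y
    ≋-*ˡ k {x} {y} (mod d) = mod (subst (+ p ∣_) (eq k x y) (∣n⇒∣m*n k d))
      where
      eq : ∀ k x y → k * (x - y) ≡ k * x - k * y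
      eq = solve-∀

  Up : (a b : Fin p) → Set
  Up a b = gap a b ≡ ↑

  module _ {n} (G : Graph n) (c : Colouring p q G) where

    private
      f = proj₁ c

    up-or-down : ∀ {u v} → Adj G u v → Up (f u) (f v) ⊎ Up (f v) (f u)
    up-or-down {u} {v} u~v with range-cases (gap-range G c u~v)
    ... | inj₂ ↑uv = inj₁ ↑uv
    ... | inj₁ qe = inj₂ (trans (gap-flip (gap-range G c u~v)) (trans (cong (λ s → + p - s) qe) p-q≡↑))

    up⇒¬down : ∀ {u v} → Adj G u v → Up (f u) (f v) → ¬ Up (f v) (f u)
    up⇒¬down {u} {v} u~v uv vu = ℤ.<-irrefl
      (trans (sym p-↑≡q) (trans (cong (λ s → + p - s) (sym uv)) (trans (sym (gap-flip (gap-range G c u~v))) vu))) q<↑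

    -- Every edge goes up in one direction, with slope 2(q + 1) - p = 1; the other direction follows
    -- by negation.
    unit-heights : ∀ {E} → (∀ {u v} → Adj G u v → Up (f u) (f v) → E v - E u ≡ 1ℤ) → Height G f E
    unit-heights {E} rises .slope {u} {v} u~v with up-or-down u~v
    ... | inj₁ uv = trans (rises u~v uv) (trans (sym 2↑-p≡1) (cong (λ s → + 2 * s - + p) (sym uv)))
    ... | inj₂ vu = trans (eq (E u) (E v)) (trans (cong -_ (rises (adj-sym G u~v) vu))
      (trans (sym 2q-p≡-1) (cong (λ s → + 2 * s - + p) (sym (trans (gap-flip (gap-range G c (adj-sym G u~v)))
        (trans (cong (λ s → + p - s) vu) p-↑≡q))))))
      where
      eq : ∀ a b → b - a ≡ - (a - b)
      eq = solve-∀

    adj⇒≢ : ∀ {u v} → Adj G u v → f u ≢ f v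
    adj⇒≢ {u} {v} u~v eq = contradiction
      (ℤ.≤-trans 1≤q (+≤+ (subst (q ℕ.≤_) (ℕ.m≡n⇒∣m-n∣≡0 (cong toℕ eq)) (proj₁ (proj₂ c u~v)))))
      λ { (+≤+ ()) }

  gap-injectiveˡ : ∀ {a b d} → gap a d ≡ gap b d → a ≡ b
  gap-injectiveˡ {a} {b} {d} eq = ⟦⟧-injective
    (≋-by₂ (≋-sym (gap-≋ b d)) (subst (_≋ ⟦ d ⟧ - ⟦ a ⟧) eq (gap-≋ a d)) (eq′ (gap b d) (⟦ a ⟧) (⟦ b ⟧) (⟦ d ⟧)))
    where
    eq′ : ∀ s a b d → ((d - b) - s) + (s - (d - a)) ≡ a - b
    eq′ = solve-∀

  gap-injectiveʳ : ∀ {a b d} → gap d a ≡ gap d b → a ≡ b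
  gap-injectiveʳ {a} {b} {d} eq = ⟦⟧-injective
    (≋-by₂ (≋-sym (gap-≋ d a)) (subst (_≋ ⟦ b ⟧ - ⟦ d ⟧) (sym eq) (gap-≋ d b)) (eq′ (gap d a) (⟦ a ⟧) (⟦ b ⟧) (⟦ d ⟧)))
    where
    eq′ : ∀ s a b d → ((a - d) - s) + (s - (b - d)) ≡ a - b
    eq′ = solve-∀

  Outcome : ∀ {n} (G : Graph n) → (Fin n → Fin p) → Set₁
  Outcome G f = G FoldsTo C ⊎ ∃ (Height G f)

  -- Quantified over graphs and colourings together, as the induction changes both.
  Claim : ℕ → Set₁
  Claim n = (G : Graph n) → Connected G → Bipartite G → (c : Colouring p q G) → Outcome G (proj₁ c)

  -- Equal colours make `x` and `y` nonadjacent, so with the neighbour `w` they are at distance 2.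
  -- All hypotheses pass to the quotient, and an outcome there lifts: folds gain one step, and a
  -- height function is composed with the fold.
  collapse : ∀ {n} → Claim n → (G : Graph (ℕ.suc n)) → Connected G → Bipartite G → (c : Colouring p q G) →
             ∀ {w x y} → Adj G w x → Adj G w y → x ≢ y → proj₁ c x ≡ proj₁ c y → Outcome G (proj₁ c)
  collapse {n} claim G conn (side , proper) c@(f , col) {w} {x} {y} w~x w~y x≢y fx≡fy =
    unfold (claim K K-connected (side ∘ punchIn y , K-proper) (f ∘ punchIn y , K-col))
    where
    dist2 : Distance G x y 2
    dist2 = adj-sym G w~x ∷ (w~y ∷ []) , far
      where
      far : ∀ k → k ℕ.< 2 → ¬ Walk G k x y
      far 0 _ [] = x≢y refl
      far 1 _ (x~y ∷ []) = adj⇒≢ G c x~y fx≡fy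
      far (ℕ.suc (ℕ.suc _)) (ℕ.s≤s (ℕ.s≤s ())) _
    y≢x = distance-2⇒≢ dist2
    K = identify G x y dist2
    π = foldMap G x y dist2
    side-factor : ∀ v → side (punchIn y (π v)) ≡ side v
    side-factor = merge-factor y≢x side (≢-both⇒≡ (proper w~y ∘ sym) (proper w~x ∘ sym))
    f-factor : ∀ v → f (punchIn y (π v)) ≡ f v
    f-factor = merge-factor y≢x f (sym fx≡fy)
    K-connected : Connected K
    K-connected a b = _ , subst₂ (Walk K _) (merge-punchIn y≢x a) (merge-punchIn y≢x b)
      (walk-map (elementaryFold G x y dist2) (proj₂ (conn (punchIn y a) (punchIn y b))))
    K-proper : ∀ {a b} → Adj K a b → side (punchIn y a) ≢ side (punchIn y b)
    K-proper (u , v , refl , refl , u~v) = subst₂ _≢_ (sym (side-factor u)) (sym (side-factor v)) (proper u~v)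
    K-col : IsColouring p q K (f ∘ punchIn y)
    K-col (u , v , refl , refl , u~v) =
      subst₂ (λ a b → Near ℕ.∣ toℕ a - toℕ b ∣) (sym (f-factor u)) (sym (f-factor v)) (col u~v)
    unfold : Outcome K (f ∘ punchIn y) → Outcome G f
    unfold (inj₁ (k , L , φ , folds , iso)) = inj₁ (k , L , _ , step x y dist2 folds , iso)
    unfold (inj₂ (E , e)) = inj₂ (E ∘ π , height λ {u} {v} u~v →
      trans (slope e (u , v , refl , refl , u~v))
            (cong₂ (λ a b → + 2 * gap a b - + p) (f-factor u) (f-factor v)))

  -- Colourings that are injective on every neighbourhood.

  module NoCollision {n} (claim : Claim n) (G : Graph (ℕ.suc n)) (conn : Connected G) (bip : Bipartite G)
    (c : Colouring p q G)
    (injective : ∀ {w x y} → Adj G w x → Adj G w y → proj₁ c x ≡ proj₁ c y → x ≡ y) where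

    private
      f = proj₁ c
      side = proj₁ bip
      proper = proj₂ bip
      V = Fin (ℕ.suc n)

      _⇑_ : V → V → Set
      u ⇑ v = Adj G u v × Up (f u) (f v)

      _⇑?_ : ∀ u v → Dec (u ⇑ v)
      u ⇑? v = adj? G u v ×-dec (gap (f u) (f v) ℤ.≟ ↑)

      ⇑-or-⇓ : ∀ {u v} → Adj G u v → u ⇑ v ⊎ v ⇑ u
      ⇑-or-⇓ u~v with up-or-down G c u~v
      ... | inj₁ uv = inj₁ (u~v , uv)
      ... | inj₂ vu = inj₂ (adj-sym G u~v , vu)

      -- All upper neighbours of a vertex have the same colour, and so have all lower ones; hence
      -- there is at most one of each.
      ⇑-uniqueʳ : ∀ {u v w} → u ⇑ v → u ⇑ w → v ≡ w
      ⇑-uniqueʳ (u~v , uv) (u~w , uw) = injective u~v u~w (gap-injectiveʳ (trans uv (sym uw)))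

      ⇑-uniqueˡ : ∀ {u v w} → v ⇑ u → w ⇑ u → v ≡ w
      ⇑-uniqueˡ (v~u , vu) (w~u , wu) = injective (adj-sym G v~u) (adj-sym G w~u) (gap-injectiveˡ (trans vu (sym wu)))

    -- Lowering v by one gives it the colour of a vertex two below it.
    peak : ∀ v → (∀ u → ¬ v ⇑ u) → Outcome G f
    peak v top with any? (adj? G v)
    -- By connectedness, `v` is the only vertex.
    ... | no isolated = inj₂ (_ , unit-heights G c {λ _ → 0ℤ} λ {a} {b} a~b _ →
      contradiction a~b (adj-irrefl G (trans (only a) (sym (only b)))))
      where
      only : ∀ u → u ≡ v
      only u = walk-closed {P = _≡ v} (λ { v~b refl → contradiction (_ , v~b) isolated }) (proj₂ (conn v u)) refl
    ... | yes (w , v~w) with ⇑-or-⇓ v~w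
    ...   | inj₁ vw = contradiction vw (top w)
    ...   | inj₂ wv with any? (_⇑? w)
    -- The graph is a single edge, with `v` above `w`.
    ...     | no bottom = inj₂ (spike v 1ℤ , unit-heights G c rises)
      where
      near : ∀ {a b} → Adj G a b → a ≡ v ⊎ a ≡ w → b ≡ v ⊎ b ≡ w
      near {b = b} a~b (inj₁ refl) with ⇑-or-⇓ a~b
      ... | inj₁ ab = contradiction ab (top b)
      ... | inj₂ ba = inj₂ (⇑-uniqueˡ ba wv)
      near {b = b} a~b (inj₂ refl) with ⇑-or-⇓ a~b
      ... | inj₁ ab = inj₁ (⇑-uniqueʳ ab wv)
      ... | inj₂ ba = contradiction (b , ba) bottom
      only : ∀ u → u ≡ v ⊎ u ≡ w
      only u = walk-closed near (proj₂ (conn v u)) (inj₁ refl)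
      w≢v : w ≢ v
      w≢v w≡v = adj-irrefl G (sym w≡v) v~w
      rises : ∀ {a b} → Adj G a b → Up (f a) (f b) → spike v 1ℤ b - spike v 1ℤ a ≡ 1ℤ
      rises {a} {b} a~b ab with only a | only b
      ... | inj₁ refl | _ = contradiction (a~b , ab) (top b)
      ... | inj₂ refl | inj₁ refl = cong₂ _-_ (spike-at v 1ℤ) (spike-off 1ℤ w≢v)
      ... | inj₂ refl | inj₂ refl = contradiction a~b (adj-irrefl G refl)
    ...     | yes (y , yw) = restore (collapse claim G conn bip c′ (proj₁ wv) (adj-sym G (proj₁ yw)) v≢y f′v≡f′y)
      where
      v≢y : v ≢ y
      v≢y refl = up⇒¬down G c (proj₁ wv) (proj₂ wv) (proj₂ yw)
      lowerable : ∀ {u} → Adj G u v → Range (gap (f u) (f v) + - 1ℤ)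
      lowerable {u} u~v with ⇑-or-⇓ u~v
      ... | inj₁ (_ , uv) = subst Range (trans (eq (+ q)) (cong (_+ - 1ℤ) (sym uv))) range-q
        where
        eq : ∀ q → q ≡ (1ℤ + q) + - 1ℤ
        eq = solve-∀
      ... | inj₂ vu = contradiction vu (top u)
      lowered = recolour G c v (- 1ℤ) lowerable
      c′ = proj₁ lowered
      f′ = proj₁ c′
      h = proj₂ lowered
      f′y≡fy : f′ y ≡ f y
      f′y≡fy = moved-0 G h (spike-off (- 1ℤ) (v≢y ∘ sym))
      f′v≡f′y : f′ v ≡ f′ y
      f′v≡f′y = trans (⟦⟧-injective (≋-trans (moved h v)
                        (≋-trans (≋-reflexive (cong (λ e → ⟦ f v ⟧ + e) (spike-at v (- 1ℤ)))) rise)))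
                      (sym f′y≡fy)
        where
        -- Two steps up from `y` add 2q + 2 = p + 1 to the colour, that is, 1 modulo p.
        rise : ⟦ f v ⟧ + - 1ℤ ≋ ⟦ f y ⟧
        rise = ≋-by₃ (≋-sym (gap-≋ (f w) (f v))) (≋-sym (gap-≋ (f y) (f w))) p≋0
          (trans (cong₂ (λ s t → (⟦ f v ⟧ - ⟦ f w ⟧ - s) + (⟦ f w ⟧ - ⟦ f y ⟧ - t) + (+ p - 0ℤ)) (proj₂ wv) (proj₂ yw))
            (trans (cong (λ r → (⟦ f v ⟧ - ⟦ f w ⟧ - ↑) + (⟦ f w ⟧ - ⟦ f y ⟧ - ↑) + (r - 0ℤ)) p≡)
              (eq (⟦ f v ⟧) (⟦ f w ⟧) (⟦ f y ⟧) (+ q))))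
          where
          eq : ∀ a b d q → (a - b - (1ℤ + q)) + (b - d - (1ℤ + q)) + ((+ 2 * q + 1ℤ) - 0ℤ) ≡ (a + - 1ℤ) - d
          eq = solve-∀
      restore : Outcome G f′ → Outcome G f
      restore (inj₁ folds)  = inj₁ folds
      restore (inj₂ (E , e)) = inj₂ (_ , height-transport G (homotopy-sym G h) e)

    module Ascent (N : V → V) (N⇑ : ∀ v → v ⇑ N v) where

      N-injective : ∀ {u v} → N u ≡ N v → u ≡ v
      N-injective {u} {v} eq = ⇑-uniqueˡ (N⇑ u) (subst (v ⇑_) (sym eq) (N⇑ v))

      adj⇒N : ∀ {u v} → Adj G u v → N u ≡ v ⊎ N v ≡ u
      adj⇒N {u} {v} u~v with ⇑-or-⇓ u~v
      ... | inj₁ uv = inj₁ (⇑-uniqueʳ (N⇑ u) uv)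
      ... | inj₂ vu = inj₂ (⇑-uniqueʳ (N⇑ v) vu)

      -- Every neighbour is a successor or a predecessor, so the orbit of `zero` is closed under
      -- adjacency and exhausts the connected graph.
      order : CyclicOrder N
      order = cyclicOrder λ v → walk-closed {P = OnOrbit} extend (proj₂ (conn zero v)) onOrbit-start
        where
        open Orbit N N-injective zero
        extend : ∀ {u v} → Adj G u v → OnOrbit u → OnOrbit v
        extend u~v on = [ (λ eq → subst OnOrbit eq (onOrbit-next on)) ,
                          (λ eq → onOrbit-previous (subst OnOrbit (sym eq) on)) ]′ (adj⇒N u~v)

    -- The remaining graphs: cycles whose length is a multiple of p.

    module Cyclic (N : V → V) (N⇑ : ∀ v → v ⇑ N v) (order : CyclicOrder N) where

      open Ascent N N⇑ using (adj⇒N)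
      open CyclicOrder order

      private
        winding : ∀ i → ⟦ f (orbit i) ⟧ ≋ ⟦ f start ⟧ + + i * ↑
        winding ℕ.zero = ≋-reflexive (sym (ℤ.+-identityʳ (⟦ f start ⟧)))
        winding (ℕ.suc i) = ≋-by₂
          (≋-sym (subst (_≋ ⟦ f (N (orbit i)) ⟧ - ⟦ f (orbit i) ⟧) (proj₂ (N⇑ (orbit i))) (gap-≋ _ _)))
          (winding i) (eq (⟦ f start ⟧) (⟦ f (orbit i) ⟧) (⟦ f (N (orbit i)) ⟧) ↑ (+ i))
          where
          eq : ∀ z a b t i → ((b - a) - t) + (a - (z + i * t)) ≡ b - (z + (1ℤ + i) * t)
          eq = solve-∀

        -- p divides period * (1 + q), hence 2 * period * (1 + q) - period * p = period.
        period≋0 : + period ≋ 0ℤ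
        period≋0 = go (+ period) (⟦ f start ⟧) full
          where
          go : ∀ k z → z + k * ↑ ≋ z → k ≋ 0ℤ
          go k z full = ≋-by₃ full full (≋-sym (≋-*ˡ k p≋0))
            (trans (cong (λ r → (z + k * ↑ - z) + (z + k * ↑ - z) + (k * 0ℤ - k * r)) p≡) (eq z k (+ q)))
            where
            eq : ∀ z k q → ((z + k * (1ℤ + q)) - z) + ((z + k * (1ℤ + q)) - z) + (k * 0ℤ - k * (+ 2 * q + 1ℤ)) ≡ k - 0ℤ
            eq = solve-∀
          full : ⟦ f start ⟧ + + period * ↑ ≋ ⟦ f start ⟧
          full = ≋-sym (subst (λ v → ⟦ f v ⟧ ≋ ⟦ f start ⟧ + + period * ↑) orbit-period (winding period))

        p∣period : p ℕ.∣ period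
        p∣period = ∣⇒∣ᵤ (subst (+ p ∣_) (ℤ.+-identityʳ (+ period)) (divisible period≋0))

        p≡1+q+q : p ≡ ℕ.suc (q ℕ.+ q)
        p≡1+q+q = trans p≡2q+1 (trans (ℕ.+-comm _ 1) (cong (λ r → ℕ.suc (q ℕ.+ r)) (ℕ.+-identityʳ q)))

        alternates : ∀ i → side (orbit (ℕ.suc i)) ≡ not (side (orbit i))
        alternates i = ¬-not (proper (proj₁ (N⇑ (orbit i))) ∘ sym)

        even-side : ∀ j → side (orbit (j ℕ.+ j)) ≡ side start
        even-side ℕ.zero = refl
        even-side (ℕ.suc j) = trans (cong (side ∘ orbit ∘ ℕ.suc) (ℕ.+-suc j j))
          (trans (alternates (ℕ.suc (j ℕ.+ j))) (trans (cong not (alternates (j ℕ.+ j)))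
            (trans (not-involutive _) (even-side j))))

        -- The sides alternate along the orbit and p is odd, so the cycle cannot close after p
        -- steps.
        period≢p : period ≢ p
        period≢p eq = not-¬ refl (trans (cong side (trans (sym orbit-period) (cong orbit (trans eq p≡1+q+q))))
          (trans (alternates (q ℕ.+ q)) (cong not (even-side q))))

        -- Runs down for one turn (p steps) and up for the rest, so that orbit (p - 1) and
        -- orbit (p + 1) get the same colour, but gains period - 2p in total.
        h : ℕ → ℤ
        h i = + ℕ.∣ i - p ∣

        h-fall : ∀ {i} → i ℕ.< p → h (ℕ.suc i) - h i ≡ - 1ℤ
        h-fall {i} i<p = trans (cong₂ _-_ (+∣-∣-≤ i<p) (+∣-∣-≤ (ℕ.<⇒≤ i<p))) (eq (+ i) (+ p))
          where
          eq : ∀ i p → (p - (1ℤ + i)) - (p - i) ≡ - 1ℤ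
          eq = solve-∀

        h-rise : ∀ {i} → p ℕ.≤ i → h (ℕ.suc i) - h i ≡ 1ℤ
        h-rise {i} p≤i = trans (cong₂ _-_ (+∣-∣-≥ (ℕ.m≤n⇒m≤1+n p≤i)) (+∣-∣-≥ p≤i)) (eq (+ i) (+ p))
          where
          eq : ∀ i p → ((1ℤ + i) - p) - (i - p) ≡ 1ℤ
          eq = solve-∀

      -- No fold is made: `G` is itself the cycle, with `index` as isomorphism.
      period≡4q+2⇒folds : period ≡ 4 ℕ.* q ℕ.+ 2 → G FoldsTo C
      period≡4q+2⇒folds k≡ = _ , G , idHom , none , mk↔ₛ′ to from to-from from-to , λ u v → mk⇔ (fwd u v) (bwd u v)
        where
        k₀ = 4 ℕ.* q ℕ.+ 2
        to : V → Fin k₀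
        to v = fromℕ< (subst (index v ℕ.<_) k≡ (index<period v))
        from : Fin k₀ → V
        from i = orbit (toℕ i)
        toℕ-to : ∀ v → toℕ (to v) ≡ index v
        toℕ-to v = toℕ-fromℕ< _
        to-from : ∀ i → to (from i) ≡ i
        to-from i = toℕ-injective (trans (toℕ-to (from i)) (index-orbit (subst (toℕ i ℕ.<_) (sym k≡) (toℕ<n i))))
        from-to : ∀ v → from (to v) ≡ v
        from-to v = trans (cong orbit (toℕ-to v)) (orbit-index v)
        S : ℕ → ℕ → ℕ → Set
        S k i j = j ≡ ℕ.suc i ⊎ (ℕ.suc i ≡ k × j ≡ 0)
        to-next : ∀ {u v} → N u ≡ v → Successor k₀ (to u) (to v)
        to-next {u} refl = subst₂ (S k₀) (sym (toℕ-to u)) (sym (toℕ-to (N u)))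
          (subst (λ k → S k (index u) (index (N u))) k≡ (index-next u))
        next-from : ∀ {u v} → Successor k₀ (to u) (to v) → N u ≡ v
        next-from {u} {v} s = next-index {u} {v}
          (subst (λ k → S k (index u) (index v)) (sym k≡) (subst₂ (S k₀) (toℕ-to u) (toℕ-to v) s))
        fwd : ∀ u v → Adj G u v → Adj C (to u) (to v)
        fwd u v u~v = [ inj₁ ∘ to-next {u} {v} , inj₂ ∘ to-next {v} {u} ]′ (adj⇒N u~v)
        bwd : ∀ u v → Adj C (to u) (to v) → Adj G u v
        bwd u v (inj₁ s) = subst (Adj G u) (next-from {u} {v} s) (proj₁ (N⇑ u))
        bwd u v (inj₂ s) = adj-sym G (subst (Adj G v) (next-from {v} {u} s) (proj₁ (N⇑ v)))

      -- Cycles longer than 2p, through a second colouring.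

      module Long (2p<period : p ℕ.+ p ℕ.< period) where

        private
          p<period : p ℕ.< period
          p<period = ℕ.≤-<-trans (ℕ.m≤m+n p p) 2p<period

          -- Both values are multiples of p, so the colouring built from `h` closes up.
          h-wrap : h period ≋ h 0
          h-wrap = ≋-by₃ (≋-reflexive (+∣-∣-≥ (ℕ.<⇒≤ p<period))) period≋0 (≋-+ (≋-sym p≋0) (≋-sym p≋0))
            (eq (h period) (+ period) (+ p))
            where
            eq : ∀ h k p → (h - (k - p)) + (k - 0ℤ) + ((0ℤ + 0ℤ) - (p + p)) ≡ h - p
            eq = solve-∀

          h-next : ∀ {i j} → Next i j → h j ≋ h (ℕ.suc i)
          h-next (inj₁ refl)           = ≋-refl
          h-next (inj₂ (1+i≡k , refl)) = ≋-sym (subst (λ k → h k ≋ h 0) (sym 1+i≡k) h-wrap)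

          -- The colouring that goes up where `h` rises and down where `h` falls.
          ψ : V → Fin p
          ψ v = reduce (↑ * h (index v))

          ψ-next : ∀ v → ⟦ ψ (N v) ⟧ - ⟦ ψ v ⟧ ≋ ↑ * (h (ℕ.suc (index v)) - h (index v))
          ψ-next v = ≋-trans
            (≋-- (≋-trans (reduce-≋ (↑ * h (index (N v)))) (≋-*ˡ ↑ (h-next (index-next v)))) (reduce-≋ (↑ * h (index v))))
            (≋-reflexive (eq ↑ (h (ℕ.suc (index v))) (h (index v))))
            where
            eq : ∀ t a b → t * a - t * b ≡ t * (a - b)
            eq = solve-∀

          -- The first half makes `ψ` a colouring; the second says that any height function for `ψ`
          -- must change as `h` does.
          StepAt : V → Set
          StepAt v = Range (gap (ψ v) (ψ (N v))) ×
                     + 2 * gap (ψ v) (ψ (N v)) - + p ≡ h (ℕ.suc (index v)) - h (index v)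

          ψ-step : ∀ v → StepAt v
          ψ-step v = [ falling , rising ]′ (ℕ.<-≤-connex (index v) p)
            where
            X = ⟦ ψ (N v) ⟧ - ⟦ ψ v ⟧
            falling : index v ℕ.< p → StepAt v
            falling i<p = subst Range (sym gap≡q) range-q ,
              trans (cong (λ s → + 2 * s - + p) gap≡q) (trans 2q-p≡-1 (sym (h-fall i<p)))
              where
              eq : ∀ q x → ((+ 2 * q + 1ℤ) - 0ℤ) + ((1ℤ + q) * - 1ℤ - x) ≡ q - x
              eq = solve-∀
              gap≡q : gap (ψ v) (ψ (N v)) ≡ + q
              -- A fall by q + 1 is a gap of q modulo p = 2q + 1.
              gap≡q = gap-unique range-q (≋-by₂ p≋0 (≋-sym (ψ-next v))
                (trans (cong₂ (λ r d → (r - 0ℤ) + (↑ * d - X)) p≡ (h-fall i<p)) (eq (+ q) X)))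
            rising : p ℕ.≤ index v → StepAt v
            rising p≤i = subst Range (sym gap≡↑) range-↑ ,
              trans (cong (λ s → + 2 * s - + p) gap≡↑) (trans 2↑-p≡1 (sym (h-rise p≤i)))
              where
              gap≡↑ : gap (ψ v) (ψ (N v)) ≡ ↑
              gap≡↑ = gap-unique range-↑ (≋-by (≋-sym (ψ-next v))
                (trans (cong (λ d → ↑ * d - X) (h-rise p≤i)) (cong (_- X) (ℤ.*-identityʳ ↑))))

          ψ-col : IsColouring p q G ψ
          ψ-col {u} {v} u~v =
            [ near u v , (λ eq → subst Near (ℕ.∣-∣-comm (toℕ (ψ v)) (toℕ (ψ u))) (near v u eq)) ]′ (adj⇒N u~v)
            where
            near : ∀ u v → N u ≡ v → Near ℕ.∣ toℕ (ψ u) - toℕ (ψ v) ∣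
            near u v eq = subst (λ w → Near ℕ.∣ toℕ (ψ u) - toℕ (ψ w) ∣) eq (gap-range⇒near (proj₁ (ψ-step u)))

          -- This is p - 1, so `r` and `r` + 2 lie on either side of the lowest point p of `h`.
          r = q ℕ.+ q

          r<p : r ℕ.< p
          r<p = ℕ.≤-reflexive (sym p≡1+q+q)

          2+r<period : ℕ.suc (ℕ.suc r) ℕ.< period
          2+r<period = ℕ.≤-<-trans (ℕ.≤-trans (ℕ.s≤s r<p) (ℕ.+-monoˡ-≤ p (ℕ.≤-<-trans ℕ.z≤n r<p))) 2p<period

          h-symmetric : h r ≡ h (ℕ.suc (ℕ.suc r))
          h-symmetric = sym (ℤ.i-j≡0⇒i≡j _ _ (trans (eq (h r) (h (ℕ.suc r)) (h (ℕ.suc (ℕ.suc r))))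
            (cong₂ _+_ (h-rise (ℕ.≤-reflexive p≡1+q+q)) (h-fall r<p))))
            where
            eq : ∀ a b c → c - a ≡ (c - b) + (b - a)
            eq = solve-∀

          folded : Outcome G ψ
          folded = collapse claim G conn bip (ψ , ψ-col)
            (adj-sym G (proj₁ (N⇑ (orbit r)))) (proj₁ (N⇑ (orbit (ℕ.suc r)))) distinct
            (cong (λ z → reduce (↑ * z)) (trans (cong h (index-orbit r<period))
              (trans h-symmetric (cong h (sym (index-orbit 2+r<period))))))
            where
            r<period = ℕ.<-trans r<p p<period
            distinct : orbit r ≢ orbit (ℕ.suc (ℕ.suc r))
            distinct eq = ℕ.<⇒≢ (ℕ.m≤n⇒m≤1+n (ℕ.n<1+n r)) (orbit-injective r<period 2+r<period eq)

          -- A height function would climb with `h` along the orbit; closing up forces period - p =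
          -- p.
          no-height : ¬ ∃ (Height G ψ)
          no-height (E , e) = ℕ.<-irrefl (sym period≡2p) 2p<period
            where
            climbs : ∀ i → i ℕ.≤ period → E (orbit i) - E start ≡ h i - h 0
            climbs ℕ.zero _ = trans (ℤ.+-inverseʳ (E start)) (sym (ℤ.+-inverseʳ (h 0)))
            climbs (ℕ.suc i) i<k = trans (eq (E (orbit i)) (E (N (orbit i))) (E start))
              (trans (cong₂ _+_ (trans (slope e (proj₁ (N⇑ (orbit i))))
                                  (trans (proj₂ (ψ-step (orbit i))) (cong (λ j → h (ℕ.suc j) - h j) (index-orbit i<k))))
                                (climbs i (ℕ.<⇒≤ i<k)))
                (sym (eq (h i) (h (ℕ.suc i)) (h 0))))
              where
              eq : ∀ a b z → b - z ≡ (b - a) + (a - z)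
              eq = solve-∀
            period≡2p : period ≡ p ℕ.+ p
            period≡2p = ℤ.+-injective (ℤ.i-j≡0⇒i≡j (+ period) (+ (p ℕ.+ p)) (trans (eq (+ period) (+ p))
              (trans (cong (_- h 0) (sym (+∣-∣-≥ (ℕ.<⇒≤ p<period))))
                (trans (sym (climbs period ℕ.≤-refl)) (ℤ.i≡j⇒i-j≡0 (cong E orbit-period))))))
              where
              eq : ∀ k p → k - (p + p) ≡ (k - p) - p
              eq = solve-∀

        -- The first alternative of `Outcome` does not mention the colouring, so what is proved with
        -- `ψ` serves for `f`.
        folds : G FoldsTo C
        folds = [ id , (λ hE → contradiction hE no-height) ]′ folded

      folds : G FoldsTo C
      folds = wound p∣period
        where
        -- Quotient 0 cannot occur as the period is positive, 1 is excluded by parity, 2 gives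
        -- length 4q + 2, and larger ones are long cycles.
        wound : p ℕ.∣ period → G FoldsTo C
        wound (ℕ.divides 1 eq) = contradiction (trans eq (ℕ.+-identityʳ p)) period≢p
        wound (ℕ.divides 2 eq) = period≡4q+2⇒folds (trans eq (trans (cong (2 ℕ.*_) p≡2q+1) (eq′ q)))
          where
          eq′ : ∀ q → 2 ℕ.* (2 ℕ.* q ℕ.+ 1) ≡ 4 ℕ.* q ℕ.+ 2
          eq′ = ℕ-solve-∀
        wound (ℕ.divides (ℕ.suc (ℕ.suc (ℕ.suc t))) eq) =
          Long.folds (subst (p ℕ.+ p ℕ.<_) (sym eq)
            (ℕ.+-monoʳ-< p (ℕ.m<m+n p (ℕ.≤-trans (ℕ.>-nonZero⁻¹ p) (ℕ.m≤m+n p (t ℕ.* p))))))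

    outcome : Outcome G f
    outcome = decide (any? λ v → ¬? (any? (v ⇑?_)))
      where
      decide : Dec (∃ λ v → ¬ ∃ (v ⇑_)) → Outcome G f
      decide (yes (v , top)) = peak v λ u vu → top (u , vu)
      decide (no ¬top) = inj₁ (Cyclic.folds (proj₁ ∘ climb) (proj₂ ∘ climb)
                                    (Ascent.order (proj₁ ∘ climb) (proj₂ ∘ climb)))
        where
        climb : ∀ v → ∃ (v ⇑_)
        climb v = decidable-stable (any? (v ⇑?_)) (λ top → ¬top (v , top))

  -- Induction on the number of vertices: a vertex with two neighbours of equal colour allows a
  -- fold, and otherwise the colouring is injective on neighbourhoods.
  fold-or-height : ∀ n → Claim n
  fold-or-height ℕ.zero    G _ _ c = inj₂ ((λ ()) , height λ { {()} })
  fold-or-height (ℕ.suc n) G conn bip c@(f , _) = decide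
    (any? λ w → any? λ x → any? λ y → adj? G w x ×-dec adj? G w y ×-dec ¬? (x ≟ y) ×-dec (f x ≟ f y))
    where
    decide : Dec (∃ λ w → ∃₂ λ x y → Adj G w x × Adj G w y × x ≢ y × f x ≡ f y) → Outcome G f
    decide (yes (w , x , y , w~x , w~y , x≢y , fx≡fy)) =
      collapse (fold-or-height n) G conn bip c w~x w~y x≢y fx≡fy
    decide (no ¬collision) = NoCollision.outcome (fold-or-height n) G conn bip c λ {w} {x} {y} w~x w~y fx≡fy →
      decidable-stable (x ≟ y) λ x≢y → ¬collision (w , x , y , w~x , w~y , x≢y , fx≡fy)

  -- A colouring of the cycle of length 4q + 2 = 2p without height function.

  winding-colouring : Σ (Colouring p q C) λ c → ¬ ∃ (Height C (proj₁ c))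
  winding-colouring = (ψ , ψ-col) , no-height
    where
    K last : ℕ
    K = 4 ℕ.* q ℕ.+ 2
    last = 4 ℕ.* q ℕ.+ 1

    1+last≡K : ℕ.suc last ≡ K
    1+last≡K = sym (ℕ.+-suc (4 ℕ.* q) 1)

    ψ : Fin K → Fin p
    ψ i = reduce (↑ * + toℕ i)

    K≋0 : + K ≋ 0ℤ
    K≋0 = subst (λ k → + k ≋ 0ℤ) (trans (cong (λ r → r ℕ.+ r) p≡2q+1) (eq q)) (≋-+ p≋0 p≋0)
      where
      eq : ∀ q → (2 ℕ.* q ℕ.+ 1) ℕ.+ (2 ℕ.* q ℕ.+ 1) ≡ 4 ℕ.* q ℕ.+ 2
      eq = ℕ-solve-∀

    next : ∀ {i j} → Successor K i j → + toℕ j ≋ 1ℤ + + toℕ i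
    next (inj₁ j≡1+i)         = ≋-reflexive (cong +_ j≡1+i)
    next (inj₂ (1+i≡K , j≡0)) = subst₂ (λ a b → + a ≋ + b) (sym j≡0) (sym 1+i≡K) (≋-sym K≋0)

    ψ-up : ∀ i j → Successor K i j → gap (ψ i) (ψ j) ≡ ↑
    ψ-up i j s = gap-unique range-↑ (≋-by
      (≋-sym (≋-- (≋-trans (reduce-≋ (↑ * + toℕ j)) (≋-*ˡ ↑ (next {i} {j} s))) (reduce-≋ (↑ * + toℕ i))))
      (eq ↑ (+ toℕ i) (⟦ ψ j ⟧ - ⟦ ψ i ⟧)))
      where
      eq : ∀ t i x → (t * (1ℤ + i) - t * i) - x ≡ t - x
      eq = solve-∀

    ψ-near : ∀ i j → Successor K i j → Near ℕ.∣ toℕ (ψ i) - toℕ (ψ j) ∣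
    ψ-near i j s = gap-range⇒near (subst Range (sym (ψ-up i j s)) range-↑)

    ψ-col : IsColouring p q C ψ
    ψ-col {i} {j} = [ ψ-near i j , (λ s → subst Near (ℕ.∣-∣-comm (toℕ (ψ j)) (toℕ (ψ i))) (ψ-near j i s)) ]′

    no-height : ¬ ∃ (Height C ψ)
    -- Going from 0 to `last` climbs by `last`, yet the closing edge from `last` to 0 must rise by
    -- one as well.
    no-height (E , e) = absurd last (trans
      (sym (trans (cong (λ z → E (at 0 0<K) - z) (climbs last last<K)) (eq (E (at 0 0<K)) (+ last))))
      (rise (at last last<K) (at 0 0<K) (inj₂ (trans (cong ℕ.suc (toℕ-fromℕ< last<K)) 1+last≡K , toℕ-fromℕ< 0<K))))
      where
      last<K : last ℕ.< K
      last<K = ℕ.≤-reflexive 1+last≡K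
      0<K : 0 ℕ.< K
      0<K = ℕ.≤-<-trans ℕ.z≤n last<K
      at : ∀ i → i ℕ.< K → Fin K
      at i i<K = fromℕ< i<K
      rise : ∀ i j → Successor K i j → E j - E i ≡ 1ℤ
      rise i j s = trans (slope e (inj₁ s)) (trans (cong (λ g → + 2 * g - + p) (ψ-up i j s)) 2↑-p≡1)
      climbs : ∀ i (i<K : i ℕ.< K) → E (at i i<K) ≡ E (at 0 0<K) + + i
      climbs ℕ.zero    i<K = sym (ℤ.+-identityʳ (E (at 0 0<K)))
      climbs (ℕ.suc i) i<K = trans (eq′ (E (at i i′<K)) (E (at (ℕ.suc i) i<K)))
        (trans (cong₂ _+_ (rise (at i i′<K) (at (ℕ.suc i) i<K)
                                (inj₁ (trans (toℕ-fromℕ< i<K) (cong ℕ.suc (sym (toℕ-fromℕ< i′<K))))))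
                          (climbs i i′<K))
          (eq″ (E (at 0 0<K)) (+ i)))
        where
        i′<K = ℕ.<-trans (ℕ.n<1+n i) i<K
        eq′ : ∀ a b → b ≡ (b - a) + a
        eq′ = solve-∀
        eq″ : ∀ z i → 1ℤ + (z + i) ≡ z + (1ℤ + i)
        eq″ = solve-∀
      eq : ∀ z k → z - (z + k) ≡ - k
      eq = solve-∀
      absurd : ∀ k → - + k ≢ 1ℤ
      absurd ℕ.zero ()
      absurd (ℕ.suc k) ()

-- The bounds on p/q in integers, and the theorem.

open import Data.Nat.Base using (_+_; _*_)
open import Data.Integer.Base using (+_)
open import Data.Rational.Unnormalised.Base using (_/_; _<_)
open import Function.Bundles using (_⇔_)

-- Cross-multiplication; matching on `q` lets the fraction compute.
2<p/q⇒2q<p : ∀ p q .{{_ : NonZero q}} → (+ 2 / 1) < (+ p / q) → 2 * q ℕ.< p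
2<p/q⇒2q<p p q@(ℕ.suc _) (*<* lt) = ℤ.drop‿+<+
  (subst₂ ℤ._<_ (sym (ℤ.pos-* 2 q)) (ℤ.*-identityʳ (+ p)) lt)

p/q<4⇒p<4q : ∀ p q .{{_ : NonZero q}} → (+ p / q) < (+ 4 / 1) → p ℕ.< 4 * q
p/q<4⇒p<4q p q@(ℕ.suc _) (*<* lt) = ℤ.drop‿+<+
  (subst₂ ℤ._<_ (ℤ.*-identityʳ (+ p)) (sym (ℤ.pos-* 4 q)) lt)

theorem2p6 : (p q : ℕ) .{{_ : NonZero p}} .{{_ : NonZero q}} →
    (+ 2 / 1) < (+ p / q) → (+ p / q) < (+ 4 / 1) →
    (∀ {m n} (G : Graph m) (H : Graph n) → G FoldsTo H → ¬ Mixing p q H → ¬ Mixing p q G)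
    × (p ≡ 2 * q + 1 → ∀ {n} (G : Graph n) → Bipartite G → Connected G →
    (Mixing p q G ⇔ (¬ (G FoldsTo cycle (4 * q + 2) (3≤4q+2 q)))))
theorem2p6 p q 2<p/q p/q<4 =
  (λ G H folds ¬mixing mixing → ¬mixing (mixing-folds-to {G = G} {H} folds mixing)) ,
  λ p≡2q+1 {n} G bip conn →
    let open OddCycle p q 2q<p p≡2q+1
        c₀ , ¬height = winding-colouring
    in mk⇔
      (λ mixing folds → ¬height (mixing⇒height C (mixing-folds-to {G = G} {C} folds mixing) c₀))
      -- Without a fold to the cycle all colourings have height functions, so any two are homotopic
      -- and hence connected.
      (λ ¬folds c d →
        let height-of = λ c → [ (λ folds → contradiction folds ¬folds) , id ]′ (fold-or-height n G conn bip c)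
            _ , hc = height-of c
            _ , hd = height-of d
        in connect G c d (proj₂ (heights⇒homotopy G conn hc hd)) hc)
  where
  2q<p = 2<p/q⇒2q<p p q 2<p/q
  p<4q = p/q<4⇒p<4q p q p/q<4
  open Circular p q 2q<p
  open Connecting p q 2q<p
  open Folding p q 2q<p p<4q
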